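{- Let $P \in [0,1]^{n\times n}$ be a stochastic matrix with rational entries and let $(X_0,X_1,\dots)$ be a Markov chain on $\{1,\dots,n\}$ with transition matrix $P$. Let $C_1,\dots,C_p$ be its recurrent classes and, for $i \in \{1,\dots,n\}$ and $\ell \in \{1,\dots,p\}$, let $\psi(i,C_\ell)$ be the probability that the chain starting at $i$ reaches $C_\ell$. Then the numbers $(\psi(i,C_\ell))_{i \in [n], \ell \in [p]}$ are rational and their lowest common denominator is not greater than $\min\{D_T, M^{n-2}\}$.
   Context: For each $i$, $M_i$ is the lowest common denominator of the entries of the $i$-th row of $P$; $M$ is the lowest common denominator of all entries of $P$. $T \subset \{1,\dots,n\}$ is the set of transient states of the chain and $D_T \coloneqq \prod_{i \in T} M_i$ (empty product equal to $1$). -}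

module Defs where

open import Data.Bool using (Bool; true; false; if_then_else_)
open import Data.Nat using (ℕ; zero; suc; _≤_)
open import Data.Nat.LCM using (lcm)
open import Data.Fin using (Fin; zero; suc; _≟_)
open import Data.Product using (Σ; ∃; _×_)
open import Data.Rational using (ℚ; 0ℚ; 1ℚ; _+_; _*_; _-_; ∣_∣; _<_)
import Data.Rational as ℚ
open import Relation.Nullary.Decidable using (⌊_⌋)

den : ℚ → ℕ
den q = ℚ.ℚ.denominatorℕ q

sumℚ : ∀ {n} → (Fin n → ℚ) → ℚ
sumℚ {zero}  f = 0ℚ
sumℚ {suc n} f = f zero + sumℚ (λ j → f (suc j))

lcmFin : ∀ {n} → (Fin n → ℕ) → ℕ
lcmFin {zero}  f = 1
lcmFin {suc n} f = lcm (f zero) (lcmFin (λ j → f (suc j)))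

prodOver : ∀ {n} → (Fin n → Bool) → (Fin n → ℕ) → ℕ
prodOver {zero}  T f = 1
prodOver {suc n} T f =
  Data.Nat._*_ (if T zero then f zero else 1) (prodOver (λ j → T (suc j)) (λ j → f (suc j)))

Matrix : ℕ → Set
Matrix n = Fin n → Fin n → ℚ

Stochastic : ∀ {n} → Matrix n → Set
Stochastic {n} P = (∀ i j → ℚ._≤_ 0ℚ (P i j) × ℚ._≤_ (P i j) 1ℚ) × (∀ i → sumℚ (P i) ≡ 1ℚ)
  where open import Relation.Binary.PropositionalEquality using (_≡_)

rowLCD : ∀ {n} → Matrix n → Fin n → ℕ
rowLCD P i = lcmFin (λ j → den (P i j))

allLCD : ∀ {n} → Matrix n → ℕ
allLCD P = lcmFin (λ i → lcmFin (λ j → den (P i j)))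

DT : ∀ {n} → Matrix n → (Fin n → Bool) → ℕ
DT P T = prodOver T (rowLCD P)

singleton : ∀ {n} → Fin n → Fin n → Bool
singleton i j = ⌊ i ≟ j ⌋

-- hit P S k i = Pr_i( chain hits S at some time t with 0 ≤ t ≤ k )
hit : ∀ {n} → Matrix n → (Fin n → Bool) → ℕ → Fin n → ℚ
hit P S zero    i = if S i then 1ℚ else 0ℚ
hit P S (suc k) i = if S i then 1ℚ else sumℚ (λ j → P i j * hit P S k j)

-- ret P i k = Pr_i( chain returns to i at some time t with 1 ≤ t ≤ k )
ret : ∀ {n} → Matrix n → Fin n → ℕ → ℚ
ret P i zero    = 0ℚ
ret P i (suc k) = sumℚ (λ j → P i j * hit P (singleton i) k j)

Converges : (ℕ → ℚ) → ℚ → Set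
Converges f q = ∀ ε → 0ℚ < ε → ∃ λ N → ∀ k → N ≤ k → ∣ f k - q ∣ < ε

Recurrent : ∀ {n} → Matrix n → Fin n → Set
Recurrent P i = Converges (ret P i) 1ℚ

Leads : ∀ {n} → Matrix n → Fin n → Fin n → Set
Leads P i j = ∃ λ k → 0ℚ < hit P (singleton j) k i

Communicate : ∀ {n} → Matrix n → Fin n → Fin n → Set
Communicate P i j = Leads P i j × Leads P j i

{-# OPTIONS --safe #-}
-- For a recurrent class C the function ψ(·, C) is the solution x of x_i = Σ_j P_ij x_j for
-- i ∈ T and x_i = [i ∈ C] for i ∉ T.  Multiplying row i ∈ T by M_i gives a system A x = b
-- with integral A and b, so det A is a common denominator by Cramer's rule.  As T is
-- transient, the expected occupation time h up to a large horizon satisfies A h > 0, so A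
-- is an M-matrix; eliminating one state after the other (Schur complements) shows that such
-- a matrix has 0 < det A ≤ ∏ A_ii, and ∏ A_ii ≤ D_T.  With at least two recurrent states
-- D_T ≤ M^(n-2); with a single one ψ = 1.
module Submission where

open import Defs
open import Data.Bool using (Bool; true; false; if_then_else_; not; _∨_)
import Data.Bool.Properties as Bool
open import Data.Fin using (Fin; zero; suc) renaming (_≟_ to _≟ᶠ_)
open import Data.Fin.Properties using (suc-injective; any?; all?; ¬∀⟶∃¬)
open import Data.Integer as ℤ using (ℤ; +_; -[1+_])
import Data.Integer.Properties as ℤ
import Data.Integer.Tactic.RingSolver as ℤ-Solver
open import Data.List using (List; []; _∷_; _++_; map; tabulate)
open import Data.List.Properties using (++-assoc; map-tabulate)
open import Data.List.Membership.Propositional using (_∈_)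
open import Data.List.Membership.Propositional.Properties using (∈-∃++; ∈-insert; ∈-tabulate⁺)
open import Data.List.Relation.Unary.All as All using (All; []; _∷_)
import Data.List.Relation.Unary.All.Properties as All
open import Data.List.Relation.Unary.Any using (here; there)
open import Data.Nat as ℕ using (ℕ; zero; suc; _∸_; _^_; _⊓_)
import Data.Nat.Properties as ℕ
open import Data.Nat.Coprimality using (1-coprimeTo; coprime?; coprime-divisor) renaming (sym to coprime-sym)
open import Data.Nat.Divisibility using (_∣_; divides; ∣-refl; ∣-trans; ∣⇒≤; 0∣⇒≡0; m∣m*n; n∣m*n)
open import Data.Nat.Induction using (<-wellFounded)
open import Data.Nat.LCM using (lcm-least; m∣lcm[m,n]; n∣lcm[m,n])
open import Data.Product using (Σ; ∃; ∃₂; _×_; _,_; proj₁; proj₂)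
open import Data.Rational hiding (_⊓_)
open import Data.Rational.Properties
import Data.Rational.Unnormalised as ℚᵘ
import Data.Rational.Unnormalised.Properties as ℚᵘ
open import Data.Sum using (_⊎_; inj₁; inj₂)
open import Data.Vec.Functional using (Vector; tail)
open import Function using (_∘_)
open import Function.Bundles using (_⇔_; mk⇔; module Equivalence)
open import Induction.WellFounded using (Acc; acc)
open import Level using (0ℓ)
open import Relation.Binary.PropositionalEquality
open import Relation.Nullary using (¬_; Dec; yes; no; does; contradiction; _×-dec_; _→-dec_)
open import Relation.Nullary.Decidable using (dec⇒maybe; dec-true; dec-false; decidable-stable; recompute)
open import Tactic.RingSolver using (solve-∀)
open import Tactic.RingSolver.Core.AlmostCommutativeRing using (AlmostCommutativeRing; fromCommutativeRing)

-- `Converges` speaks of rational limits only, so `ψ` cannot be defined as a limit. It is produced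
-- algebraically, by elimination in the linear system, and only then identified with the limit of
-- `hit`: the error vanishes outside `T` and is averaged by `P` inside `T`, hence is at most a
-- constant times the probability of still being in `T`. `Recurrent` is itself a limit statement and
-- gives no direct means of decision. It is replaced by the graph property that every reachable
-- state leads back, which a finite search decides; the equivalence of the two makes the Boolean `T`
-- usable. The vector h serves twice: it witnesses the M-matrix property, and since each step inside
-- `T` lowers it by a fixed amount, the probability of surviving k steps is O(1/k). The system keeps
-- all n coordinates, with identity rows outside `T`. No reindexing of `T` is needed, the extra
-- diagonal entries contribute factors 1, and one determinant serves all recurrent classes because
-- only the right-hand side depends on the class.

ℚ-ring : AlmostCommutativeRing 0ℓ 0ℓ
ℚ-ring = fromCommutativeRing +-*-commutativeRing (λ x → dec⇒maybe (0ℚ ≟ x))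

-- Ordered-field arithmetic and finite sums in ℚ

minus : ∀ p q → p - q ≡ p + (- 1ℚ) * q
minus = solve-∀ ℚ-ring

≤⇒0≤- : ∀ {p q} → p ≤ q → 0ℚ ≤ q - p
≤⇒0≤- {p} {q} p≤q = subst (_≤ q - p) (+-inverseʳ p) (+-monoˡ-≤ (- p) p≤q)

p-q+q≡p : ∀ p q → p - q + q ≡ p
p-q+q≡p = solve-∀ ℚ-ring

0≤-⇒≤ : ∀ {p q} → 0ℚ ≤ q - p → p ≤ q
0≤-⇒≤ {p} {q} h = subst₂ _≤_ (+-identityˡ p) (p-q+q≡p q p) (+-monoˡ-≤ p h)

<⇒0<- : ∀ {p q} → p < q → 0ℚ < q - p
<⇒0<- {p} {q} p<q = subst (_< q - p) (+-inverseʳ p) (+-monoˡ-< (- p) p<q)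

0<-⇒< : ∀ {p q} → 0ℚ < q - p → p < q
0<-⇒< {p} {q} h = subst₂ _<_ (+-identityˡ p) (p-q+q≡p q p) (+-monoˡ-< p h)

0≤+ : ∀ {p q} → 0ℚ ≤ p → 0ℚ ≤ q → 0ℚ ≤ p + q
0≤+ = +-mono-≤

0≤* : ∀ {p q} → 0ℚ ≤ p → 0ℚ ≤ q → 0ℚ ≤ p * q
0≤* {p} {q} 0≤p 0≤q = nonNegative⁻¹ (p * q)
  {{nonNeg*nonNeg⇒nonNeg p {{nonNegative 0≤p}} q {{nonNegative 0≤q}}}}

0<* : ∀ {p q} → 0ℚ < p → 0ℚ < q → 0ℚ < p * q
0<* {p} {q} 0<p 0<q = positive⁻¹ (p * q) {{pos*pos⇒pos p {{positive 0<p}} q {{positive 0<q}}}}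

*-mono-≤ : ∀ {p q r s} → 0ℚ ≤ p → 0ℚ ≤ s → p ≤ q → r ≤ s → p * r ≤ q * s
*-mono-≤ {p} {q} {r} {s} 0≤p 0≤s p≤q r≤s =
  ≤-trans (*-monoˡ-≤-nonNeg p {{nonNegative 0≤p}} r≤s) (*-monoʳ-≤-nonNeg s {{nonNegative 0≤s}} p≤q)

inverse : ∀ {p} → 0ℚ < p → ∃ λ q → 0ℚ < q × p * q ≡ 1ℚ
inverse {p} 0<p = (1/ p) , positive⁻¹ (1/ p) {{1/pos⇒pos p}} , *-inverseʳ p
  where instance
    _ = positive 0<p
    _ = pos⇒nonZero p

sum-cong : ∀ {n} {f g : Vector ℚ n} → (∀ i → f i ≡ g i) → sumℚ f ≡ sumℚ g
sum-cong {zero}  f≗g = refl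
sum-cong {suc n} f≗g = cong₂ _+_ (f≗g zero) (sum-cong (f≗g ∘ suc))

sum-linear : ∀ {n} (f g : Vector ℚ n) a → sumℚ (λ i → f i + a * g i) ≡ sumℚ f + a * sumℚ g
sum-linear {zero}  f g a = base a
  where
  base : ∀ a → 0ℚ ≡ 0ℚ + a * 0ℚ
  base = solve-∀ ℚ-ring
sum-linear {suc n} f g a =
  trans (cong (λ z → (f zero + a * g zero) + z) (sum-linear (f ∘ suc) (g ∘ suc) a))
        (step (f zero) (g zero) a (sumℚ (f ∘ suc)) (sumℚ (g ∘ suc)))
  where
  step : ∀ x y a s t → (x + a * y) + (s + a * t) ≡ (x + s) + a * (y + t)
  step = solve-∀ ℚ-ring

sum-zero : ∀ {n} (f : Vector ℚ n) → (∀ i → f i ≡ 0ℚ) → sumℚ f ≡ 0ℚ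
sum-zero {zero}  f f≗0 = refl
sum-zero {suc n} f f≗0 = cong₂ _+_ (f≗0 zero) (sum-zero (f ∘ suc) (f≗0 ∘ suc))

sum-single : ∀ {n} (f : Vector ℚ n) j → (∀ k → k ≢ j → f k ≡ 0ℚ) → sumℚ f ≡ f j
sum-single f zero    off =
  trans (cong (λ z → f zero + z) (sum-zero (f ∘ suc) (λ k → off (suc k) λ ()))) (+-identityʳ (f zero))
sum-single f (suc j) off =
  trans (cong₂ _+_ (off zero λ ()) (sum-single (f ∘ suc) j (λ k k≢j → off (suc k) (k≢j ∘ suc-injective))))
        (+-identityˡ (f (suc j)))

sum-mono : ∀ {n} {f g : Vector ℚ n} → (∀ i → f i ≤ g i) → sumℚ f ≤ sumℚ g
sum-mono {zero}  f≤g = ≤-refl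
sum-mono {suc n} f≤g = +-mono-≤ (f≤g zero) (sum-mono (f≤g ∘ suc))

-- Determinants

-- Laplace expansion along the first coordinate of a list of columns; the first
-- argument of expand holds the truncated columns already passed, and the
-- alternating sign comes from the nested subtraction.  A list whose length is
-- not n gets the value 0.
det    : ∀ {n} → List (Vector ℚ n) → ℚ
expand : ∀ {n} → List (Vector ℚ n) → List (Vector ℚ (suc n)) → ℚ

det {zero}  []      = 1ℚ
det {zero}  (_ ∷ _) = 0ℚ
det {suc n} cs      = expand [] cs

expand pre []       = 0ℚ
expand pre (c ∷ cs) = c zero * det (pre ++ map tail cs) - expand (pre ++ tail c ∷ []) cs

-- The three lists share all columns but one, where the combination holds. Asking for it pointwise
-- avoids function extensionality.
data Linear {n} (a : ℚ) : (ws us vs : List (Vector ℚ n)) → Set where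
  here  : ∀ {w u v l} → (∀ i → w i ≡ u i + a * v i) → Linear a (w ∷ l) (u ∷ l) (v ∷ l)
  there : ∀ {ws us vs} c → Linear a ws us vs → Linear a (c ∷ ws) (c ∷ us) (c ∷ vs)

Linear-++ˡ : ∀ {n a} {ws us vs : List (Vector ℚ n)} xs → Linear a ws us vs →
             Linear a (xs ++ ws) (xs ++ us) (xs ++ vs)
Linear-++ˡ []       p = p
Linear-++ˡ (x ∷ xs) p = there x (Linear-++ˡ xs p)

Linear-++ʳ : ∀ {n a} {ws us vs : List (Vector ℚ n)} ys → Linear a ws us vs →
             Linear a (ws ++ ys) (us ++ ys) (vs ++ ys)
Linear-++ʳ ys (here e)    = here e
Linear-++ʳ ys (there c p) = there c (Linear-++ʳ ys p)

Linear-tail : ∀ {n a} {ws us vs : List (Vector ℚ (suc n))} → Linear a ws us vs →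
              Linear a (map tail ws) (map tail us) (map tail vs)
Linear-tail (here e)    = here (e ∘ suc)
Linear-tail (there c p) = there (tail c) (Linear-tail p)

-- During the expansion the distinguished column is either still ahead or already truncated into the
-- prefix; the two `expand` lemmas treat these cases, and the first falls back on the second once
-- the column is passed.
det-linear     : ∀ {n a} {ws us vs : List (Vector ℚ n)} → Linear a ws us vs →
                 det ws ≡ det us + a * det vs
expand-linearʳ : ∀ {n a} pre {ws us vs : List (Vector ℚ (suc n))} → Linear a ws us vs →
                 expand pre ws ≡ expand pre us + a * expand pre vs
expand-linearˡ : ∀ {n a} {ws us vs : List (Vector ℚ n)} → Linear a ws us vs → ∀ cs →
                 expand ws cs ≡ expand us cs + a * expand vs cs

det-linear {zero} {a} (here _)    = sum-linear {0} (λ ()) (λ ()) a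
det-linear {zero} {a} (there _ _) = sum-linear {0} (λ ()) (λ ()) a
det-linear {suc n} p = expand-linearʳ [] p

expand-linearʳ {a = a} pre {vs = v ∷ l} (here {w} {u} e)
  rewrite e zero | expand-linearˡ {a = a} (Linear-++ˡ pre (here {w = tail w} {tail u} {tail v} {[]} (e ∘ suc))) l =
  step (u zero) (v zero) a (det (pre ++ map tail l)) (expand (pre ++ tail u ∷ []) l) (expand (pre ++ tail v ∷ []) l)
  where
  step : ∀ x y a d s t → (x + a * y) * d - (s + a * t) ≡ (x * d - s) + a * (y * d - t)
  step = solve-∀ ℚ-ring
expand-linearʳ {a = a} pre (there {ws} {us} {vs} c p)
  rewrite det-linear (Linear-++ˡ pre (Linear-tail p)) | expand-linearʳ (pre ++ tail c ∷ []) p =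
  step (c zero) a (det (pre ++ map tail us)) (det (pre ++ map tail vs))
       (expand (pre ++ tail c ∷ []) us) (expand (pre ++ tail c ∷ []) vs)
  where
  step : ∀ x a d e s t → x * (d + a * e) - (s + a * t) ≡ (x * d - s) + a * (x * e - t)
  step = solve-∀ ℚ-ring

expand-linearˡ {a = a} p [] = sum-linear {0} (λ ()) (λ ()) a
expand-linearˡ {a = a} {us = us} {vs = vs} p (c ∷ cs)
  rewrite det-linear (Linear-++ʳ (map tail cs) p) | expand-linearˡ (Linear-++ʳ (tail c ∷ []) p) cs =
  step (c zero) a (det (us ++ map tail cs)) (det (vs ++ map tail cs))
       (expand (us ++ tail c ∷ []) cs) (expand (vs ++ tail c ∷ []) cs)
  where
  step : ∀ x a d e s t → x * (d + a * e) - (s + a * t) ≡ (x * d - s) + a * (x * e - t)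
  step = solve-∀ ℚ-ring

data Repeat {n} : List (Vector ℚ n) → Set where
  here  : ∀ u l → Repeat (u ∷ u ∷ l)
  there : ∀ c {l} → Repeat l → Repeat (c ∷ l)

Repeat-++ˡ : ∀ {n} xs {l : List (Vector ℚ n)} → Repeat l → Repeat (xs ++ l)
Repeat-++ˡ []       p = p
Repeat-++ˡ (x ∷ xs) p = there x (Repeat-++ˡ xs p)

Repeat-++ʳ : ∀ {n} {l : List (Vector ℚ n)} ys → Repeat l → Repeat (l ++ ys)
Repeat-++ʳ ys (here u l)  = here u (l ++ ys)
Repeat-++ʳ ys (there c p) = there c (Repeat-++ʳ ys p)

Repeat-tail : ∀ {n} {l : List (Vector ℚ (suc n))} → Repeat l → Repeat (map tail l)
Repeat-tail (here u l)  = here (tail u) (map tail l)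
Repeat-tail (there c p) = there (tail c) (Repeat-tail p)

-- Two adjacent equal columns yield the same minor with opposite signs; every other minor contains
-- the truncated pair and vanishes by induction.
det-repeat     : ∀ {n} {l : List (Vector ℚ n)} → Repeat l → det l ≡ 0ℚ
expand-repeatʳ : ∀ {n} pre {l : List (Vector ℚ (suc n))} → Repeat l → expand pre l ≡ 0ℚ
expand-repeatˡ : ∀ {n} {l : List (Vector ℚ n)} → Repeat l → ∀ cs → expand l cs ≡ 0ℚ

det-repeat {zero}  (here u l)  = refl
det-repeat {zero}  (there c p) = refl
det-repeat {suc n} p           = expand-repeatʳ [] p

expand-repeatʳ pre (here u l)
  rewrite ++-assoc pre (tail u ∷ []) (map tail l)
        | ++-assoc pre (tail u ∷ []) (tail u ∷ [])
        | expand-repeatˡ (Repeat-++ˡ pre (here (tail u) [])) l =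
  step (u zero * det (pre ++ tail u ∷ map tail l))
  where
  step : ∀ x → x - (x - 0ℚ) ≡ 0ℚ
  step = solve-∀ ℚ-ring
expand-repeatʳ pre (there c p)
  rewrite det-repeat (Repeat-++ˡ pre (Repeat-tail p)) | expand-repeatʳ (pre ++ tail c ∷ []) p =
  step (c zero)
  where
  step : ∀ x → x * 0ℚ - 0ℚ ≡ 0ℚ
  step = solve-∀ ℚ-ring

expand-repeatˡ p [] = refl
expand-repeatˡ p (c ∷ cs)
  rewrite det-repeat (Repeat-++ʳ (map tail cs) p) | expand-repeatˡ (Repeat-++ʳ (tail c ∷ []) p) cs =
  step (c zero)
  where
  step : ∀ x → x * 0ℚ - 0ℚ ≡ 0ℚ
  step = solve-∀ ℚ-ring

-- Polarisation: expand the vanishing determinant with `u+v` in both places.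
det-swap : ∀ {n} xs (u v : Vector ℚ n) ys → det (xs ++ u ∷ v ∷ ys) ≡ - det (xs ++ v ∷ u ∷ ys)
det-swap xs u v ys = step (D u v) (D v u) (begin
  0ℚ                                                    ≡⟨ sym (det-repeat (Repeat-++ˡ xs (here u+v ys))) ⟩
  D u+v u+v                                             ≡⟨ det-linear {a = 1ℚ} (Linear-++ˡ xs (here {v = v} (λ _ → refl))) ⟩
  D u u+v + 1ℚ * D v u+v                                ≡⟨ cong₂ (λ a b → a + 1ℚ * b) (right u) (right v) ⟩
  (D u u + 1ℚ * D u v) + 1ℚ * (D v u + 1ℚ * D v v)      ≡⟨ cong₂ (λ a b → (a + 1ℚ * D u v) + 1ℚ * (D v u + 1ℚ * b))
                                                              (det-repeat (Repeat-++ˡ xs (here u ys)))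
                                                              (det-repeat (Repeat-++ˡ xs (here v ys))) ⟩
  (0ℚ + 1ℚ * D u v) + 1ℚ * (D v u + 1ℚ * 0ℚ)            ∎)
  where
  open ≡-Reasoning
  D : _ → _ → ℚ
  D a b = det (xs ++ a ∷ b ∷ ys)
  u+v : Vector ℚ _
  u+v i = u i + 1ℚ * v i
  right : ∀ a → D a u+v ≡ D a u + 1ℚ * D a v
  right a = det-linear {a = 1ℚ} (Linear-++ˡ xs (there a (here {v = v} (λ _ → refl))))
  rearrange : ∀ s t → s ≡ ((0ℚ + 1ℚ * s) + 1ℚ * (t + 1ℚ * 0ℚ)) - t
  rearrange = solve-∀ ℚ-ring
  step : ∀ s t → 0ℚ ≡ (0ℚ + 1ℚ * s) + 1ℚ * (t + 1ℚ * 0ℚ) → s ≡ - t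
  step s t e = trans (rearrange s t) (trans (cong (_- t) (sym e)) (+-identityˡ (- t)))

-- Adjacent swaps carry `u` to the right until it meets its copy.
det-repeated : ∀ {n} xs {u : Vector ℚ n} ys → u ∈ ys → det (xs ++ u ∷ ys) ≡ 0ℚ
det-repeated xs (u ∷ ys) (here refl) = det-repeat (Repeat-++ˡ xs (here u ys))
det-repeated xs {u} (y ∷ ys) (there u∈ys) = begin
  det (xs ++ u ∷ y ∷ ys)             ≡⟨ det-swap xs u y ys ⟩
  - det (xs ++ y ∷ u ∷ ys)           ≡⟨ cong (λ l → - det l) (sym (++-assoc xs (y ∷ []) (u ∷ ys))) ⟩
  - det ((xs ++ y ∷ []) ++ u ∷ ys)   ≡⟨ cong -_ (det-repeated (xs ++ y ∷ []) ys u∈ys) ⟩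
  0ℚ                                 ∎
  where open ≡-Reasoning

det-repeated-before : ∀ {n} xs {u : Vector ℚ n} ys → u ∈ xs → det (xs ++ u ∷ ys) ≡ 0ℚ
det-repeated-before xs {u} ys u∈xs with ∈-∃++ u∈xs
... | as , bs , refl = trans (cong det (++-assoc as (u ∷ bs) (u ∷ ys)))
                             (det-repeated as (bs ++ u ∷ ys) (∈-insert bs))

-- Cramer's rule

columns : ∀ {n} → Matrix n → List (Vector ℚ n)
columns A = tabulate (λ j i → A i j)

infixl 7 _·_
_·_ : ∀ {n} → Matrix n → Vector ℚ n → Vector ℚ n
(A · x) i = sumℚ (λ j → A i j * x j)

det-combination : ∀ {n m} xs ys (c : Fin m → Vector ℚ n) (x : Vector ℚ m) →
  det (xs ++ (λ i → sumℚ (λ k → c k i * x k)) ∷ ys) ≡ sumℚ (λ k → x k * det (xs ++ c k ∷ ys))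
det-combination {m = zero} xs ys c x =
  -- The zero column is itself minus itself, so its determinant d equals d - d.
  trans (det-linear {a = - 1ℚ} (Linear-++ˡ xs (here {u = λ _ → 0ℚ} {v = λ _ → 0ℚ} (λ _ → refl)))) (cancel (det (xs ++ (λ _ → 0ℚ) ∷ ys)))
  where
  cancel : ∀ d → d + (- 1ℚ) * d ≡ 0ℚ
  cancel = solve-∀ ℚ-ring
det-combination {m = suc m} xs ys c x = begin
  _                                       ≡⟨ det-linear {a = x zero} (Linear-++ˡ xs (here {u = rest} {v = c zero} (λ i → swap (c zero i) (x zero) (rest i)))) ⟩
  det (xs ++ rest ∷ ys) + x zero * head   ≡⟨ +-comm _ (x zero * head) ⟩
  x zero * head + det (xs ++ rest ∷ ys)   ≡⟨ cong (λ z → x zero * head + z) (det-combination xs ys (c ∘ suc) (x ∘ suc)) ⟩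
  _                                       ∎
  where
  open ≡-Reasoning
  rest : Vector ℚ _
  rest i = sumℚ (λ k → c (suc k) i * x (suc k))
  head : ℚ
  head = det (xs ++ c zero ∷ ys)
  swap : ∀ a b r → a * b + r ≡ r + b * a
  swap = solve-∀ ℚ-ring

tabulate-split : ∀ {a} {X : Set a} {n} (f : Fin n → X) j → ∃₂ λ xs ys →
  tabulate f ≡ xs ++ f j ∷ ys × (∀ k → k ≢ j → f k ∈ xs ⊎ f k ∈ ys)
tabulate-split f zero = [] , tabulate (f ∘ suc) , refl , others
  where
  others : ∀ k → k ≢ zero → f k ∈ [] ⊎ f k ∈ tabulate (f ∘ suc)
  others zero    k≢0 = contradiction refl k≢0
  others (suc k) _   = inj₂ (∈-tabulate⁺ k)
tabulate-split f (suc j) with tabulate-split (f ∘ suc) j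
... | xs , ys , eq , old = f zero ∷ xs , ys , cong (f zero ∷_) eq , others
  where
  others : ∀ k → k ≢ suc j → f k ∈ f zero ∷ xs ⊎ f k ∈ ys
  others zero    _ = inj₁ (here refl)
  others (suc k) k≢j with old k (k≢j ∘ cong suc)
  ... | inj₁ p = inj₁ (there p)
  ... | inj₂ p = inj₂ p

-- With `A · x` in place of column `j`, linearity gives a sum over k in which every term with k
-- other than `j` repeats a column. The split of the columns is returned so that integrality of the
-- remaining ones can be read off.
cramer : ∀ {n} (A : Matrix n) (x : Vector ℚ n) j → ∃₂ λ xs ys →
  columns A ≡ xs ++ (λ i → A i j) ∷ ys × x j * det (columns A) ≡ det (xs ++ A · x ∷ ys)
cramer A x j with tabulate-split (λ k i → A i k) j
... | xs , ys , eq , others = xs , ys , eq , (begin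
  x j * det (columns A)                             ≡⟨ cong (λ l → x j * det l) eq ⟩
  x j * det (xs ++ (λ i → A i j) ∷ ys)              ≡⟨ sym (sum-single _ j vanish) ⟩
  sumℚ (λ k → x k * det (xs ++ (λ i → A i k) ∷ ys)) ≡⟨ sym (det-combination xs ys (λ k i → A i k) x) ⟩
  det (xs ++ A · x ∷ ys)                            ∎)
  where
  open ≡-Reasoning
  vanish : ∀ k → k ≢ j → x k * det (xs ++ (λ i → A i k) ∷ ys) ≡ 0ℚ
  vanish k k≢j with others k k≢j
  ... | inj₁ k∈xs = trans (cong (x k *_) (det-repeated-before xs ys k∈xs)) (*-zeroʳ (x k))
  ... | inj₂ k∈ys = trans (cong (x k *_) (det-repeated xs ys k∈ys)) (*-zeroʳ (x k))

-- Column elimination and Schur complements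

expand-zero : ∀ {n} pre (cs : List (Vector ℚ (suc n))) → All (λ c → c zero ≡ 0ℚ) cs → expand pre cs ≡ 0ℚ
expand-zero pre []       []           = refl
expand-zero pre (c ∷ cs) (c₀≡0 ∷ cs₀) rewrite c₀≡0 | expand-zero (pre ++ tail c ∷ []) cs cs₀ =
  step (det (pre ++ map tail cs))
  where
  step : ∀ d → 0ℚ * d - 0ℚ ≡ 0ℚ
  step = solve-∀ ℚ-ring

-- Here `r` stands for the inverse of the pivot `u zero`; the column operation then kills the entry
-- `v zero`.
clear : ∀ {n} → Vector ℚ (suc n) → ℚ → Vector ℚ (suc n) → Vector ℚ (suc n)
clear u r v i = v i + (- (v zero * r)) * u i

det-clear : ∀ {n} (u : Vector ℚ (suc n)) r xs ys →
            det (u ∷ xs ++ map (clear u r) ys) ≡ det (u ∷ xs ++ ys)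
det-clear u r xs []       = refl
det-clear u r xs (y ∷ ys) = begin
  det (u ∷ xs ++ y′ ∷ ys′)            ≡⟨ det-linear {a = - (y zero * r)} (Linear-++ˡ (u ∷ xs) (here {u = y} {v = u} (λ _ → refl))) ⟩
  det (u ∷ xs ++ y ∷ ys′) + (- (y zero * r)) * det (u ∷ xs ++ u ∷ ys′)
    ≡⟨ cong (λ z → det (u ∷ xs ++ y ∷ ys′) + (- (y zero * r)) * z) (det-repeated-before (u ∷ xs) ys′ (here refl)) ⟩
  det (u ∷ xs ++ y ∷ ys′) + (- (y zero * r)) * 0ℚ
    ≡⟨ drop (det (u ∷ xs ++ y ∷ ys′)) (- (y zero * r)) ⟩
  det (u ∷ xs ++ y ∷ ys′)             ≡⟨ cong (λ l → det (u ∷ l)) (sym (++-assoc xs (y ∷ []) ys′)) ⟩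
  det (u ∷ (xs ++ y ∷ []) ++ ys′)     ≡⟨ det-clear u r (xs ++ y ∷ []) ys ⟩
  det (u ∷ (xs ++ y ∷ []) ++ ys)      ≡⟨ cong (λ l → det (u ∷ l)) (++-assoc xs (y ∷ []) ys) ⟩
  det (u ∷ xs ++ y ∷ ys)              ∎
  where
  open ≡-Reasoning
  y′ : Vector ℚ _
  y′ = clear u r y
  ys′ : List (Vector ℚ _)
  ys′ = map (clear u r) ys
  drop : ∀ d a → d + a * 0ℚ ≡ d
  drop = solve-∀ ℚ-ring

schur : ∀ {n} → ℚ → Matrix (suc n) → Matrix n
schur r A i j = clear (λ k → A k zero) r (λ k → A k (suc j)) (suc i)

-- After clearing, the first row is zero beyond the pivot, so only the first term of the expansion
-- remains.
det-schur : ∀ {n} (A : Matrix (suc n)) r → A zero zero * r ≡ 1ℚ →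
            det (columns A) ≡ A zero zero * det (columns (schur r A))
det-schur A r a₀₀r≡1 = begin
  det (u ∷ cs)                                          ≡⟨ sym (det-clear u r [] cs) ⟩
  u zero * det (map tail cs′) - expand (tail u ∷ []) cs′ ≡⟨ cong₂ (λ l z → u zero * det l - z) truncated
                                                               (expand-zero (tail u ∷ []) cs′ cleared) ⟩
  u zero * det (columns (schur r A)) - 0ℚ               ≡⟨ +-identityʳ _ ⟩
  u zero * det (columns (schur r A))                    ∎
  where
  open ≡-Reasoning
  u : Vector ℚ _
  u k = A k zero
  cs cs′ : List (Vector ℚ _)
  cs = tabulate (λ j k → A k (suc j))
  cs′ = map (clear u r) cs
  truncated : map tail cs′ ≡ columns (schur r A)
  truncated = trans (cong (map tail) (map-tabulate (λ j k → A k (suc j)) (clear u r)))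
                   (map-tabulate (λ j → clear u r (λ k → A k (suc j))) tail)
  rearrange : ∀ v r p → v + (- (v * r)) * p ≡ v * (1ℚ - p * r)
  rearrange = solve-∀ ℚ-ring
  clear-zero : ∀ v → clear u r v zero ≡ 0ℚ
  clear-zero v = trans (rearrange (v zero) r (u zero))
    (trans (cong (λ z → v zero * (1ℚ - z)) a₀₀r≡1) (*-zeroʳ (v zero)))
  cleared : All (λ c → c zero ≡ 0ℚ) cs′
  cleared = All.map⁺ (All.universal clear-zero cs)

-- M-matrices

-- Among the equivalent descriptions of nonsingular M-matrices, the one by a positive vector with
-- positive image is inherited by Schur complements: the truncated vector still works.
record IsMMatrix {n} (A : Matrix n) : Set where
  field
    off-diagonal : ∀ i j → i ≢ j → A i j ≤ 0ℚ
    witness      : Vector ℚ n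
    witness>0    : ∀ i → 0ℚ < witness i
    image>0      : ∀ i → 0ℚ < (A · witness) i

schur-· : ∀ {n} (A : Matrix (suc n)) r (x : Vector ℚ n) i →
  (schur r A · x) i ≡
  sumℚ (λ j → A (suc i) (suc j) * x j) + (- (r * A (suc i) zero)) * sumℚ (λ j → A zero (suc j) * x j)
schur-· A r x i = trans
  (sum-cong (λ j → rearrange (A (suc i) (suc j)) (A zero (suc j)) r (A (suc i) zero) (x j)))
  (sum-linear (λ j → A (suc i) (suc j) * x j) (λ j → A zero (suc j) * x j) (- (r * A (suc i) zero)))
  where
  rearrange : ∀ b c r a x → (b + (- (c * r)) * a) * x ≡ b * x + (- (r * a)) * (c * x)
  rearrange = solve-∀ ℚ-ring

0≤neg : ∀ {p} → p ≤ 0ℚ → 0ℚ ≤ - p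
0≤neg = neg-antimono-≤

nonPos*pos : ∀ {p q} → p ≤ 0ℚ → 0ℚ ≤ q → p * q ≤ 0ℚ
nonPos*pos {p} {q} p≤0 0≤q = subst (p * q ≤_) (*-zeroˡ q) (*-monoʳ-≤-nonNeg q {{nonNegative 0≤q}} p≤0)

module _ {n} {A : Matrix (suc n)} (isM : IsMMatrix A) where
  open IsMMatrix isM

  private
    h₀ : ℚ
    h₀ = witness zero
    h′ : Vector ℚ n
    h′ = witness ∘ suc
    rest : ℚ
    rest = sumℚ (λ j → A zero (suc j) * h′ j)

  -- The off-diagonal terms of `(A · witness) zero` are at most 0, so the diagonal term must be
  -- positive.
  pivot>0 : 0ℚ < A zero zero
  pivot>0 = *-cancelʳ-<-nonNeg h₀ {{nonNegative (<⇒≤ (witness>0 zero))}}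
    (subst (_< A zero zero * h₀) (sym (*-zeroˡ h₀))
      (<-≤-trans (image>0 zero)
        (subst (A zero zero * h₀ + rest ≤_) (+-identityʳ _) (+-monoʳ-≤ (A zero zero * h₀) rest≤0))))
    where
    rest≤0 : rest ≤ 0ℚ
    rest≤0 = subst (rest ≤_) (sum-zero {n} (λ _ → 0ℚ) (λ _ → refl))
      (sum-mono (λ j → nonPos*pos (off-diagonal zero (suc j) λ ()) (<⇒≤ (witness>0 (suc j)))))

  schur-IsMMatrix : ∀ {r} → 0ℚ < r → A zero zero * r ≡ 1ℚ → IsMMatrix (schur r A)
  schur-IsMMatrix {r} 0<r a₀₀r≡1 = record
    { off-diagonal = λ i j i≢j → off i j (i≢j ∘ suc-injective)
    ; witness      = h′
    ; witness>0    = witness>0 ∘ suc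
    ; image>0      = image
    }
    where
    off : ∀ i j → suc i ≢ suc j → schur r A i j ≤ 0ℚ
    off i j i≢j = +-mono-≤ (off-diagonal (suc i) (suc j) i≢j)
      (subst (_≤ 0ℚ) (rearrange (A zero (suc j)) r (A (suc i) zero))
        (nonPos*pos (off-diagonal zero (suc j) λ ())
          (0≤* (<⇒≤ 0<r) (0≤neg (off-diagonal (suc i) zero λ ())))))
      where
      rearrange : ∀ c r a → c * (r * - a) ≡ (- (c * r)) * a
      rearrange = solve-∀ ℚ-ring
    image : ∀ i → 0ℚ < (schur r A · h′) i
    -- Given that `A zero zero * r` is 1, the entry equals `(A · witness) (suc i)` plus `- α * r`
    -- times `(A · witness) zero`: a positive and a nonnegative term.
    image i = subst (0ℚ <_)
      (trans (rearrange α r h₀ rest Sᵢ (A zero zero))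
        (trans (cong (λ z → (Sᵢ + (- (r * α)) * rest) + α * h₀ * (1ℚ - z)) a₀₀r≡1)
          (trans (drop _ (α * h₀)) (sym (schur-· A r h′ i)))))
      (+-mono-<-≤ (image>0 (suc i))
        (0≤* (0≤* (0≤neg (off-diagonal (suc i) zero λ ())) (<⇒≤ 0<r)) (<⇒≤ (image>0 zero))))
      where
      α Sᵢ : ℚ
      α = A (suc i) zero
      Sᵢ = sumℚ (λ j → A (suc i) (suc j) * h′ j)
      rearrange : ∀ α r h s t a → (α * h + t) + - α * r * (a * h + s) ≡ (t + (- (r * α)) * s) + α * h * (1ℚ - a * r)
      rearrange = solve-∀ ℚ-ring
      drop : ∀ x y → x + y * (1ℚ - 1ℚ) ≡ x
      drop = solve-∀ ℚ-ring

prodℚ : ∀ {n} → Vector ℚ n → ℚ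
prodℚ {zero}  f = 1ℚ
prodℚ {suc n} f = f zero * prodℚ (f ∘ suc)

IsMMatrix⇒det>0 : ∀ {n} {A : Matrix n} → IsMMatrix A → 0ℚ < det (columns A)
IsMMatrix⇒det>0 {zero}      isM = positive⁻¹ 1ℚ
IsMMatrix⇒det>0 {suc n} {A} isM with inverse (pivot>0 isM)
... | r , 0<r , a₀₀r≡1 = subst (0ℚ <_) (sym (det-schur A r a₀₀r≡1))
  (0<* (pivot>0 isM) (IsMMatrix⇒det>0 (schur-IsMMatrix isM 0<r a₀₀r≡1)))

-- Hadamard's inequality: passing to a Schur complement does not increase the diagonal.
IsMMatrix⇒det≤∏ : ∀ {n} {A : Matrix n} → IsMMatrix A → (s : Vector ℚ n) → (∀ i → A i i ≤ s i) →
                  det (columns A) ≤ prodℚ s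
IsMMatrix⇒det≤∏ {zero}      isM s diag = ≤-refl
IsMMatrix⇒det≤∏ {suc n} {A} isM s diag with inverse (pivot>0 isM)
... | r , 0<r , a₀₀r≡1 = subst (_≤ prodℚ s) (sym (det-schur A r a₀₀r≡1))
  (*-mono-≤ (<⇒≤ (pivot>0 isM)) (≤-trans (<⇒≤ (IsMMatrix⇒det>0 isM′)) bound) (diag zero) bound)
  where
  open IsMMatrix isM
  isM′ : IsMMatrix (schur r A)
  isM′ = schur-IsMMatrix isM 0<r a₀₀r≡1
  rearrange : ∀ c r a → - (- c * (r * - a)) ≡ (- (c * r)) * a
  rearrange = solve-∀ ℚ-ring
  diag′ : ∀ i → schur r A i i ≤ s (suc i)
  diag′ i = ≤-trans (subst (schur r A i i ≤_) (+-identityʳ _) (+-monoʳ-≤ (A (suc i) (suc i))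
      (subst (_≤ 0ℚ) (rearrange (A zero (suc i)) r (A (suc i) zero))
        (neg-antimono-≤ (0≤* (0≤neg (off-diagonal zero (suc i) λ ()))
          (0≤* (<⇒≤ 0<r) (0≤neg (off-diagonal (suc i) zero λ ()))))))))
    (diag (suc i))
  bound : det (columns (schur r A)) ≤ prodℚ (s ∘ suc)
  bound = IsMMatrix⇒det≤∏ isM′ (s ∘ suc) diag′

-- `cramer` evaluates a solution already at hand. Existence comes from elimination: the Schur
-- complement determines the later unknowns, then the first equation gives `x zero`.
IsMMatrix⇒solvable : ∀ {n} {A : Matrix n} → IsMMatrix A → (b : Vector ℚ n) → ∃ λ x → ∀ i → (A · x) i ≡ b i
IsMMatrix⇒solvable {zero}      isM b = b , λ ()
IsMMatrix⇒solvable {suc n} {A} isM b with inverse (pivot>0 isM)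
... | r , 0<r , a₀₀r≡1
  with IsMMatrix⇒solvable (schur-IsMMatrix isM 0<r a₀₀r≡1)
         (λ i → b (suc i) + (- (r * A (suc i) zero)) * b zero)
... | x′ , solves′ = x , solves
  where
  rest : ℚ
  rest = sumℚ (λ j → A zero (suc j) * x′ j)
  x : Vector ℚ (suc n)
  x zero    = r * (b zero - rest)
  x (suc j) = x′ j
  solves : ∀ i → (A · x) i ≡ b i
  solves zero = trans (rearrange (A zero zero) r (b zero) rest)
    (trans (cong (λ z → z * (b zero - rest) + rest) a₀₀r≡1) (cancel (b zero) rest))
    where
    rearrange : ∀ a r b s → a * (r * (b - s)) + s ≡ (a * r) * (b - s) + s
    rearrange = solve-∀ ℚ-ring
    cancel : ∀ b s → 1ℚ * (b - s) + s ≡ b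
    cancel = solve-∀ ℚ-ring
  solves (suc i) = trans (rearrange (A (suc i) zero) r (b zero) rest Sᵢ)
    (trans (cong (_+ (r * A (suc i) zero) * b zero) (trans (sym (schur-· A r x′ i)) (solves′ i)))
      (cancel (b (suc i)) (r * A (suc i) zero) (b zero)))
    where
    Sᵢ : ℚ
    Sᵢ = sumℚ (λ j → A (suc i) (suc j) * x′ j)
    rearrange : ∀ α r b s t → α * (r * (b - s)) + t ≡ (t + (- (r * α)) * s) + (r * α) * b
    rearrange = solve-∀ ℚ-ring
    cancel : ∀ b c d → (b + (- c) * d) + c * d ≡ b
    cancel = solve-∀ ℚ-ring

-- Integers inside ℚ, denominators, the Archimedean property

fromℤ : ℤ → ℚ
fromℤ z = mkℚ z 0 (coprime-sym (1-coprimeTo ℤ.∣ z ∣))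

fromℤ-+ : ∀ a b → fromℤ a + fromℤ b ≡ fromℤ (a ℤ.+ b)
fromℤ-+ a b = toℚᵘ-injective (ℚᵘ.≃-trans (toℚᵘ-homo-+ (fromℤ a) (fromℤ b)) (ℚᵘ.*≡* (step a b)))
  where
  step : ∀ a b → (a ℤ.* + 1 ℤ.+ b ℤ.* + 1) ℤ.* + 1 ≡ (a ℤ.+ b) ℤ.* + 1
  step = ℤ-Solver.solve-∀

fromℤ-* : ∀ a b → fromℤ a * fromℤ b ≡ fromℤ (a ℤ.* b)
fromℤ-* a b = toℚᵘ-injective (ℚᵘ.≃-trans (toℚᵘ-homo-* (fromℤ a) (fromℤ b)) (ℚᵘ.*≡* refl))

fromℤ-neg : ∀ a → - fromℤ a ≡ fromℤ (ℤ.- a)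
fromℤ-neg (+ zero)  = refl
fromℤ-neg (+ suc _) = refl
fromℤ-neg -[1+ _ ]  = refl

Integral : ℚ → Set
Integral q = ∃ λ z → q ≡ fromℤ z

Integral-+ : ∀ {p q} → Integral p → Integral q → Integral (p + q)
Integral-+ (a , refl) (b , refl) = a ℤ.+ b , fromℤ-+ a b

Integral-* : ∀ {p q} → Integral p → Integral q → Integral (p * q)
Integral-* (a , refl) (b , refl) = a ℤ.* b , fromℤ-* a b

Integral-neg : ∀ {p} → Integral p → Integral (- p)
Integral-neg (a , refl) = ℤ.- a , fromℤ-neg a

IntegralVector : ∀ {n} → Vector ℚ n → Set
IntegralVector v = ∀ i → Integral (v i)

det-integral    : ∀ {n} {cs : List (Vector ℚ n)} → All IntegralVector cs → Integral (det cs)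
expand-integral : ∀ {n} {pre : List (Vector ℚ n)} {cs} → All IntegralVector pre → All IntegralVector cs →
                  Integral (expand pre cs)

det-integral {zero}  []      = + 1 , refl
det-integral {zero}  (_ ∷ _) = + 0 , refl
det-integral {suc n} ints    = expand-integral [] ints

expand-integral ps []       = + 0 , refl
expand-integral ps (i ∷ is) = Integral-+
  (Integral-* (i zero) (det-integral (All.++⁺ ps (All.map⁺ (All.map (_∘ suc) is)))))
  (Integral-neg (expand-integral (All.++⁺ ps ((i ∘ suc) ∷ [])) is))

cramer-integral : ∀ {n} (A : Matrix n) (x : Vector ℚ n) → (∀ i → IntegralVector (A i)) →
  IntegralVector (A · x) → ∀ j → Integral (x j * det (columns A))
cramer-integral A x A-int b-int j with cramer A x j
... | xs , ys , eq , solves = subst Integral (sym solves)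
  (det-integral (All.++⁺ (All.++⁻ˡ xs all) (b-int ∷ All.tail (All.++⁻ʳ xs all))))
  where
  all : All IntegralVector (xs ++ (λ i → A i j) ∷ ys)
  all = subst (All IntegralVector) eq (All.tabulate⁺ (λ k i → A-int i k))

-- With x = p/q in lowest terms and x D = z, the denominator q divides p D and is coprime to p.
-- Coprimality is an irrelevant field of `mkℚ`, so it is recomputed from its decision procedure.
den-divides : ∀ x D → Integral (x * fromℤ D) → den x ∣ ℤ.∣ D ∣
den-divides x@(mkℚ p q-1 c) D (z , eq) = coprime-divisor (coprime-sym (recompute (coprime? ℤ.∣ p ∣ (suc q-1)) c)) (divides ℤ.∣ z ∣ (begin
  ℤ.∣ p ∣ ℕ.* ℤ.∣ D ∣    ≡⟨ sym (ℤ.abs-* p D) ⟩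
  ℤ.∣ p ℤ.* D ∣          ≡⟨ cong ℤ.∣_∣ (trans (sym (ℤ.*-identityʳ (p ℤ.* D))) (trans cross (cong (λ m → z ℤ.* + m) (ℕ.*-identityʳ (suc q-1))))) ⟩
  ℤ.∣ z ℤ.* + suc q-1 ∣  ≡⟨ ℤ.abs-* z (+ suc q-1) ⟩
  ℤ.∣ z ∣ ℕ.* suc q-1    ∎))
  where
  open ≡-Reasoning
  cross : (p ℤ.* D) ℤ.* + 1 ≡ z ℤ.* + (suc q-1 ℕ.* 1)
  cross = ℚᵘ.drop-*≡* (ℚᵘ.≃-trans (ℚᵘ.≃-sym (toℚᵘ-homo-* x (fromℤ D))) (ℚᵘ.≃-reflexive (cong toℚᵘ eq)))

multiple-integral : ∀ m x → den x ∣ m → Integral (fromℤ (+ m) * x)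
multiple-integral m x@(mkℚ p q-1 c) (divides k refl) = + k ℤ.* p ,
  toℚᵘ-injective (ℚᵘ.≃-trans (toℚᵘ-homo-* (fromℤ (+ m)) x) (ℚᵘ.*≡* (begin
    (+ (k ℕ.* suc q-1) ℤ.* p) ℤ.* + 1         ≡⟨ cong (λ z → (z ℤ.* p) ℤ.* + 1) (ℤ.pos-* k (suc q-1)) ⟩
    ((+ k ℤ.* + suc q-1) ℤ.* p) ℤ.* + 1       ≡⟨ step (+ k) (+ suc q-1) p ⟩
    (+ k ℤ.* p) ℤ.* (+ 1 ℤ.* + suc q-1)       ≡⟨ cong ((+ k ℤ.* p) ℤ.*_) (sym (ℤ.pos-* 1 (suc q-1))) ⟩
    (+ k ℤ.* p) ℤ.* + (1 ℕ.* suc q-1)         ∎)))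
  where
  open ≡-Reasoning
  step : ∀ k q p → ((k ℤ.* q) ℤ.* p) ℤ.* + 1 ≡ (k ℤ.* p) ℤ.* (+ 1 ℤ.* q)
  step = ℤ-Solver.solve-∀

fromℤ-cancel-< : ∀ {a b} → fromℤ a < fromℤ b → a ℤ.< b
fromℤ-cancel-< {a} {b} (*<* p) = subst₂ ℤ._<_ (ℤ.*-identityʳ a) (ℤ.*-identityʳ b) p

fromℤ-cancel-≤ : ∀ {a b} → fromℤ a ≤ fromℤ b → a ℤ.≤ b
fromℤ-cancel-≤ {a} {b} (*≤* p) = subst₂ ℤ._≤_ (ℤ.*-identityʳ a) (ℤ.*-identityʳ b) p

fromℤ-mono-≤ : ∀ {a b} → a ℤ.≤ b → fromℤ a ≤ fromℤ b
fromℤ-mono-≤ {a} {b} p = *≤* (subst₂ ℤ._≤_ (sym (ℤ.*-identityʳ a)) (sym (ℤ.*-identityʳ b)) p)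

0≤fromℕ : ∀ k → 0ℚ ≤ fromℤ (+ k)
0≤fromℕ k = fromℤ-mono-≤ {+ 0} {+ k} (ℤ.+≤+ ℕ.z≤n)

prodℚ-prodOver : ∀ {n} (T : Fin n → Bool) (f : Fin n → ℕ) →
  prodℚ (λ i → fromℤ (+ (if T i then f i else 1))) ≡ fromℤ (+ prodOver T f)
prodℚ-prodOver {zero}  T f = refl
prodℚ-prodOver {suc n} T f = begin
  fromℤ (+ f₀) * prodℚ (λ i → fromℤ (+ (if T (suc i) then f (suc i) else 1)))
    ≡⟨ cong (fromℤ (+ f₀) *_) (prodℚ-prodOver (T ∘ suc) (f ∘ suc)) ⟩
  fromℤ (+ f₀) * fromℤ (+ p)    ≡⟨ fromℤ-* (+ f₀) (+ p) ⟩
  fromℤ (+ f₀ ℤ.* + p)          ≡⟨ cong fromℤ (sym (ℤ.pos-* f₀ p)) ⟩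
  fromℤ (+ (f₀ ℕ.* p))          ∎
  where
  open ≡-Reasoning
  f₀ p : ℕ
  f₀ = if T zero then f zero else 1
  p = prodOver (T ∘ suc) (f ∘ suc)

below-natural : ∀ q → ∃ λ k → q < fromℤ (+ k)
below-natural q@(mkℚ p d-1 _) = suc ℤ.∣ p ∣ , *<* (begin-strict
  p ℤ.* + 1                        ≡⟨ ℤ.*-identityʳ p ⟩
  p                                ≤⟨ i≤∣i∣ p ⟩
  + ℤ.∣ p ∣                        <⟨ ℤ.+<+ (ℕ.n<1+n ℤ.∣ p ∣) ⟩
  + suc ℤ.∣ p ∣                    ≤⟨ ℤ.+≤+ (ℕ.m≤m*n (suc ℤ.∣ p ∣) (suc d-1)) ⟩
  + (suc ℤ.∣ p ∣ ℕ.* suc d-1)      ≡⟨ ℤ.pos-* (suc ℤ.∣ p ∣) (suc d-1) ⟩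
  + suc ℤ.∣ p ∣ ℤ.* + suc d-1      ∎)
  where
  open ℤ.≤-Reasoning
  i≤∣i∣ : ∀ i → i ℤ.≤ + ℤ.∣ i ∣
  i≤∣i∣ (+ _)    = ℤ.≤-refl
  i≤∣i∣ -[1+ _ ] = ℤ.-≤+

archimedean : ∀ C {c} → 0ℚ < c → ∃ λ K → ∀ k → K ℕ.≤ k → C < fromℤ (+ k) * c
archimedean C {c} 0<c with inverse 0<c
... | r , 0<r , cr≡1 with below-natural (C * r)
...   | K , Cr<K = K , λ k K≤k → <-≤-trans
        (subst (_< fromℤ (+ K) * c) Crc≡C (*-monoˡ-<-pos c {{positive 0<c}} Cr<K))
        (*-monoʳ-≤-nonNeg c {{nonNegative (<⇒≤ 0<c)}} (fromℤ-mono-≤ (ℤ.+≤+ K≤k)))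
  where
  rearrange : ∀ C r c → C * r * c ≡ C * (c * r)
  rearrange = solve-∀ ℚ-ring
  Crc≡C : C * r * c ≡ C
  Crc≡C = trans (rearrange C r c) (trans (cong (C *_) cr≡1) (*-identityʳ C))

-- Counting and uniform bounds over finite index sets

does⁻ : ∀ {a} {A : Set a} (a? : Dec A) → does a? ≡ true → A
does⁻ (yes a) _ = a

false≢true : ∀ {b} → b ≡ false → b ≢ true
false≢true refl ()

count : ∀ {n} → (Fin n → Bool) → ℕ
count {zero}  f = 0
count {suc n} f = (if f zero then 1 else 0) ℕ.+ count (f ∘ suc)

if-mono : ∀ {a b} → (a ≡ true → b ≡ true) → (if a then 1 else 0) ℕ.≤ (if b then 1 else 0)
if-mono {false}        _ = ℕ.z≤n
if-mono {true} {true}  _ = ℕ.≤-refl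
if-mono {true} {false} h = contradiction (h refl) λ ()

count-mono : ∀ {n} {f g : Fin n → Bool} → (∀ k → f k ≡ true → g k ≡ true) → count f ℕ.≤ count g
count-mono {zero}  f⊆g = ℕ.z≤n
count-mono {suc n} f⊆g = ℕ.+-mono-≤ (if-mono (f⊆g zero)) (count-mono (f⊆g ∘ suc))

count-strict : ∀ {n} {f g : Fin n → Bool} → (∀ k → f k ≡ true → g k ≡ true) →
               ∀ i → f i ≡ false → g i ≡ true → count f ℕ.< count g
count-strict f⊆g zero    fi gi rewrite fi | gi = ℕ.s≤s (count-mono (f⊆g ∘ suc))
count-strict f⊆g (suc i) fi gi = ℕ.+-mono-≤-< (if-mono (f⊆g zero)) (count-strict (f⊆g ∘ suc) i fi gi)

lower-bound : ∀ {n} (f : Vector ℚ n) → (∀ i → 0ℚ < f i) → ∃ λ δ → 0ℚ < δ × (∀ i → δ ≤ f i)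
lower-bound {zero}  f f>0 = 1ℚ , positive⁻¹ 1ℚ , λ ()
lower-bound {suc n} f f>0 with lower-bound (f ∘ suc) (f>0 ∘ suc)
... | δ , 0<δ , δ≤ with ≤-total (f zero) δ
...   | inj₁ f₀≤δ = f zero , f>0 zero , λ { zero → ≤-refl ; (suc i) → ≤-trans f₀≤δ (δ≤ i) }
...   | inj₂ δ≤f₀ = δ , 0<δ , λ { zero → δ≤f₀ ; (suc i) → δ≤ i }

upper-bound : ∀ {n} (f : Vector ℚ n) → ∃ λ C → 0ℚ < C × (∀ i → f i ≤ C)
upper-bound {zero}  f = 1ℚ , positive⁻¹ 1ℚ , λ ()
upper-bound {suc n} f with upper-bound (f ∘ suc)
... | C , 0<C , ≤C with ≤-total (f zero) C
...   | inj₁ f₀≤C = C , 0<C , λ { zero → f₀≤C ; (suc i) → ≤C i }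
...   | inj₂ C≤f₀ = f zero , <-≤-trans 0<C C≤f₀ , λ { zero → ≤-refl ; (suc i) → ≤-trans (≤C i) C≤f₀ }

uniform-index : ∀ {n p} {Q : ℕ → Fin n → Set p} → (∀ {k l i} → k ℕ.≤ l → Q k i → Q l i) →
                (∀ i → ∃ λ k → Q k i) → ∃ λ k → ∀ i → Q k i
uniform-index {zero}  up ex = 0 , λ ()
uniform-index {suc n} up ex with ex zero | uniform-index up (ex ∘ suc)
... | k , q | l , qs = k ℕ.⊔ l , λ { zero → up (ℕ.m≤m⊔n k l) q ; (suc i) → up (ℕ.m≤n⊔m k l) (qs i) }

sum-nonNeg : ∀ {n} {f : Vector ℚ n} → (∀ i → 0ℚ ≤ f i) → 0ℚ ≤ sumℚ f
sum-nonNeg {zero}  f≥0 = ≤-refl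
sum-nonNeg {suc n} f≥0 = 0≤+ (f≥0 zero) (sum-nonNeg (f≥0 ∘ suc))

term≤sum : ∀ {n} {f : Vector ℚ n} → (∀ i → 0ℚ ≤ f i) → ∀ j → f j ≤ sumℚ f
term≤sum {f = f} f≥0 zero = subst (_≤ sumℚ f) (+-identityʳ _) (+-monoʳ-≤ (f zero) (sum-nonNeg (f≥0 ∘ suc)))
term≤sum {f = f} f≥0 (suc j) = subst (_≤ sumℚ f) (+-identityˡ _) (+-mono-≤ (f≥0 zero) (term≤sum (f≥0 ∘ suc) j))

∣sum∣≤sum∣∣ : ∀ {n} (f : Vector ℚ n) → ∣ sumℚ f ∣ ≤ sumℚ (∣_∣ ∘ f)
∣sum∣≤sum∣∣ {zero}  f = ≤-refl
∣sum∣≤sum∣∣ {suc n} f = ≤-trans (∣p+q∣≤∣p∣+∣q∣ (f zero) (sumℚ (f ∘ suc))) (+-monoʳ-≤ ∣ f zero ∣ (∣sum∣≤sum∣∣ (f ∘ suc)))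

singleton-true : ∀ {n} {i j : Fin n} → singleton i j ≡ true → i ≡ j
singleton-true {i = i} {j} h with i ≟ᶠ j
... | yes i≡j = i≡j

singleton-refl : ∀ {n} (i : Fin n) → singleton i i ≡ true
singleton-refl i with i ≟ᶠ i
... | yes _   = refl
... | no  i≢i = contradiction refl i≢i

-- The transition matrix as an averaging operator

module Chain {n} (P : Matrix n) (stochastic : Stochastic P) where

  P≥0 : ∀ i j → 0ℚ ≤ P i j
  P≥0 i j = proj₁ (proj₁ stochastic i j)

  edge-or-zero : ∀ i j → 0ℚ < P i j ⊎ P i j ≡ 0ℚ
  edge-or-zero i j with 0ℚ <? P i j
  ... | yes p = inj₁ p
  ... | no ¬p = inj₂ (≤-antisym (≮⇒≥ ¬p) (P≥0 i j))

  ·-mono : ∀ {f g} → (∀ j → f j ≤ g j) → ∀ i → (P · f) i ≤ (P · g) i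
  ·-mono f≤g i = sum-mono (λ j → *-monoˡ-≤-nonNeg (P i j) {{nonNegative (P≥0 i j)}} (f≤g j))

  ·-linear : ∀ f g a i → (P · (λ j → f j + a * g j)) i ≡ (P · f) i + a * (P · g) i
  ·-linear f g a i = trans (sum-cong (λ j → rearrange (P i j) (f j) a (g j)))
    (sum-linear (λ j → P i j * f j) (λ j → P i j * g j) a)
    where
    rearrange : ∀ p f a g → p * (f + a * g) ≡ p * f + a * (p * g)
    rearrange = solve-∀ ℚ-ring

  ·-const : ∀ a i → (P · (λ _ → a)) i ≡ a
  ·-const a i = begin
    sumℚ (λ j → P i j * a)                  ≡⟨ sum-cong (λ j → rearrange (P i j) a) ⟩
    sumℚ (λ j → 0ℚ + a * P i j)             ≡⟨ sum-linear (λ _ → 0ℚ) (P i) a ⟩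
    sumℚ {n} (λ _ → 0ℚ) + a * sumℚ (P i)    ≡⟨ cong₂ (λ x y → x + a * y) (sum-zero {n} (λ _ → 0ℚ) (λ _ → refl)) (proj₂ stochastic i) ⟩
    0ℚ + a * 1ℚ                             ≡⟨ drop a ⟩
    a                                       ∎
    where
    open ≡-Reasoning
    rearrange : ∀ p a → p * a ≡ 0ℚ + a * p
    rearrange = solve-∀ ℚ-ring
    drop : ∀ a → 0ℚ + a * 1ℚ ≡ a
    drop = solve-∀ ℚ-ring

  ·-scale : ∀ f a i → (P · (λ j → a * f j)) i ≡ a * (P · f) i
  ·-scale f a i = begin
    (P · (λ j → a * f j)) i            ≡⟨ sum-cong (λ j → cong (P i j *_) (sym (+-identityˡ (a * f j)))) ⟩
    (P · (λ j → 0ℚ + a * f j)) i       ≡⟨ ·-linear (λ _ → 0ℚ) f a i ⟩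
    (P · (λ _ → 0ℚ)) i + a * (P · f) i ≡⟨ cong (_+ a * (P · f) i) (·-const 0ℚ i) ⟩
    0ℚ + a * (P · f) i                 ≡⟨ +-identityˡ (a * (P · f) i) ⟩
    a * (P · f) i                      ∎
    where open ≡-Reasoning

  ∣·∣≤ : ∀ f i → ∣ (P · f) i ∣ ≤ (P · (λ j → ∣ f j ∣)) i
  ∣·∣≤ f i = ≤-trans (∣sum∣≤sum∣∣ (λ j → P i j * f j)) (≤-reflexive (sum-cong (λ j →
    trans (∣p*q∣≡∣p∣*∣q∣ (P i j) (f j)) (cong (_* ∣ f j ∣) (0≤p⇒∣p∣≡p (P≥0 i j))))))

  ·-nonNeg : ∀ {f} → (∀ j → 0ℚ ≤ f j) → ∀ i → 0ℚ ≤ (P · f) i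
  ·-nonNeg f≥0 i = sum-nonNeg (λ j → 0≤* (P≥0 i j) (f≥0 j))

  ·-≤ : ∀ {f a} → (∀ j → f j ≤ a) → ∀ i → (P · f) i ≤ a
  ·-≤ {f} {a} f≤a i = subst ((P · f) i ≤_) (·-const a i) (·-mono f≤a i)

  ·-pos : ∀ {f i j} → (∀ j → 0ℚ ≤ f j) → 0ℚ < P i j → 0ℚ < f j → 0ℚ < (P · f) i
  ·-pos {i = i} {j} f≥0 edge fj>0 =
    <-≤-trans (0<* edge fj>0) (term≤sum (λ k → 0≤* (P≥0 i k) (f≥0 k)) j)

  -- The deficit `1 - f` is nonnegative, so its average is at least its `j` term alone.
  ·-gap : ∀ {f i j ε} → (∀ j → f j ≤ 1ℚ) → f j ≤ 1ℚ - ε → (P · f) i ≤ 1ℚ - P i j * ε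
  ·-gap {f} {i} {j} {ε} f≤1 fj≤ = 0≤-⇒≤ (subst (0ℚ ≤_) eq (≤⇒0≤- gap))
    where
    g : Vector ℚ n
    g k = 1ℚ + (- 1ℚ) * f k
    g≥0 : ∀ k → 0ℚ ≤ g k
    g≥0 k = subst (0ℚ ≤_) (minus 1ℚ (f k)) (≤⇒0≤- (f≤1 k))
    regroup : ∀ f ε → 1ℚ - ε - f ≡ 1ℚ + (- 1ℚ) * f - ε
    regroup = solve-∀ ℚ-ring
    gap : P i j * ε ≤ (P · g) i
    gap = ≤-trans
      (*-monoˡ-≤-nonNeg (P i j) {{nonNegative (P≥0 i j)}} (0≤-⇒≤ (subst (0ℚ ≤_) (regroup (f j) ε) (≤⇒0≤- fj≤))))
      (term≤sum (λ k → 0≤* (P≥0 i k) (g≥0 k)) j)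
    swap : ∀ s t → (1ℚ + (- 1ℚ) * s) - t ≡ 1ℚ - t - s
    swap = solve-∀ ℚ-ring
    eq : (P · g) i - P i j * ε ≡ 1ℚ - P i j * ε - (P · f) i
    eq = trans (cong (_- P i j * ε) (trans (·-linear (λ _ → 1ℚ) f (- 1ℚ) i) (cong (_+ (- 1ℚ) * (P · f) i) (·-const 1ℚ i))))
               (swap ((P · f) i) (P i j * ε))

  -- Reachability

  data Reach (S : Fin n → Bool) (i : Fin n) : Set where
    stop : S i ≡ true → Reach S i
    step : ∀ {j} → 0ℚ < P i j → Reach S j → Reach S i

  Reaches : Fin n → Fin n → Set
  Reaches i j = Reach (singleton j) i

  Reaches-refl : ∀ {i} → Reaches i i
  Reaches-refl {i} = stop (singleton-refl i)

  Reaches-Reach : ∀ {S i j} → Reaches i j → Reach S j → Reach S i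
  Reaches-Reach (stop j≡i) q with singleton-true j≡i
  ... | refl = q
  Reaches-Reach (step e p) q = step e (Reaches-Reach p q)

  Reach⇒Reaches : ∀ {S i} → Reach S i → ∃ λ j → S j ≡ true × Reaches i j
  Reach⇒Reaches {i = i} (stop s) = i , s , Reaches-refl
  Reach⇒Reaches (step e p) with Reach⇒Reaches p
  ... | j , s , q = j , s , step e q

  private
    -- Backward search: `A` holds states known to reach `S` and gains one predecessor at a time, so
    -- its complement shrinks. Once no edge enters `A` from outside, `A` contains every state that
    -- reaches `S`.
    saturate : ∀ S (A : Fin n → Bool) → (∀ i → A i ≡ true → Reach S i) → (∀ i → S i ≡ true → A i ≡ true) →
      Acc ℕ._<_ (count (not ∘ A)) → ∀ i → Dec (Reach S i)
    saturate S A sound base (acc rec)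
      with any? (λ i → any? (λ j → (A i Bool.≟ false) ×-dec ((0ℚ <? P i j) ×-dec (A j Bool.≟ true))))
    ... | yes (i , j , Ai , edge , Aj) = saturate S A′ sound′ (λ k s → cong (_∨ does (k ≟ᶠ i)) (base k s))
          (rec (count-strict shrink i (cong not grown) (cong not Ai)))
      where
      A′ : Fin n → Bool
      A′ k = A k ∨ does (k ≟ᶠ i)
      grown : A′ i ≡ true
      grown = trans (cong (_∨ does (i ≟ᶠ i)) Ai) (dec-true (i ≟ᶠ i) refl)
      sound′ : ∀ k → A′ k ≡ true → Reach S k
      sound′ k A′k with A k in eq
      ... | true  = sound k eq
      ... | false with does⁻ (k ≟ᶠ i) A′k
      ...   | refl = step edge (sound j Aj)
      shrink : ∀ k → not (A′ k) ≡ true → not (A k) ≡ true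
      shrink k h with A k
      ... | false = refl
      ... | true  = h
    ... | no closed = decide
      where
      complete : ∀ {i} → Reach S i → A i ≡ true
      complete (stop s) = base _ s
      complete {i} (step {j} e p) with A i in eq
      ... | true  = refl
      ... | false = contradiction (i , j , eq , e , complete p) closed
      decide : ∀ i → Dec (Reach S i)
      decide i with A i in eq
      ... | true  = yes (sound i eq)
      ... | false = no λ p → false≢true eq (complete p)

  reach? : ∀ S i → Dec (Reach S i)
  reach? S = saturate S S (λ i → stop) (λ i s → s) (<-wellFounded _)

  reaches? : ∀ i j → Dec (Reaches i j)
  reaches? i j = reach? (singleton j) i

  -- Hitting probabilities

  hit-bounds : ∀ S k i → 0ℚ ≤ hit P S k i × hit P S k i ≤ 1ℚ
  hit-bounds S zero i with S i
  ... | true  = nonNegative⁻¹ 1ℚ , ≤-refl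
  ... | false = ≤-refl , nonNegative⁻¹ 1ℚ
  hit-bounds S (suc k) i with S i
  ... | true  = nonNegative⁻¹ 1ℚ , ≤-refl
  ... | false = ·-nonNeg (proj₁ ∘ hit-bounds S k) i , ·-≤ (proj₂ ∘ hit-bounds S k) i

  hit≡1 : ∀ {S} k {i} → S i ≡ true → hit P S k i ≡ 1ℚ
  hit≡1 zero    Si rewrite Si = refl
  hit≡1 (suc k) Si rewrite Si = refl

  hit≡0 : ∀ {S} k {i} → ¬ Reach S i → hit P S k i ≡ 0ℚ
  hit≡0 {S} k {i} ¬p with S i in eq
  hit≡0 {S} k {i} ¬p | true = contradiction (stop eq) ¬p
  hit≡0 {S} zero {i} ¬p | false rewrite eq = refl
  hit≡0 {S} (suc k) {i} ¬p | false rewrite eq = sum-zero _ term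
    where
    term : ∀ j → P i j * hit P S k j ≡ 0ℚ
    term j with edge-or-zero i j
    ... | inj₁ e = trans (cong (P i j *_) (hit≡0 k (¬p ∘ step e))) (*-zeroʳ (P i j))
    ... | inj₂ z = trans (cong (_* hit P S k j) z) (*-zeroˡ (hit P S k j))

  Reach⇔hit>0 : ∀ {S i} → Reach S i ⇔ (∃ λ k → 0ℚ < hit P S k i)
  Reach⇔hit>0 {S} = mk⇔ to from
    where
    to : ∀ {i} → Reach S i → ∃ λ k → 0ℚ < hit P S k i
    to {i} (stop s) = 0 , subst (0ℚ <_) (sym (hit≡1 {S} 0 {i} s)) (positive⁻¹ 1ℚ)
    to {i} (step e p) with to p
    ... | k , h = suc k , lemma
      where
      lemma : 0ℚ < hit P S (suc k) i
      lemma with S i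
      ... | true  = positive⁻¹ 1ℚ
      ... | false = ·-pos (proj₁ ∘ hit-bounds S k) e h
    from : ∀ {i} → (∃ λ k → 0ℚ < hit P S k i) → Reach S i
    from {i} (k , h) = decidable-stable (reach? S i) λ ¬p → <-irrefl (sym (hit≡0 k ¬p)) h

  -- A chain started in the closed set `R` never sees the targets elsewhere. This permits enlarging
  -- a target outside the states reachable from the start.
  hit-agree : (R : Fin n → Set) → (∀ {i j} → R i → 0ℚ < P i j → R j) →
    ∀ {S S′} → (∀ {i} → R i → S i ≡ S′ i) → ∀ k {i} → R i → hit P S k i ≡ hit P S′ k i
  hit-agree R closed {S} {S′} agree zero    r rewrite agree r = refl
  hit-agree R closed {S} {S′} agree (suc k) {i} r rewrite agree r =
    cong (if S′ i then 1ℚ else_) (sum-cong term)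
    where
    term : ∀ j → P i j * hit P S k j ≡ P i j * hit P S′ k j
    term j with edge-or-zero i j
    ... | inj₁ e = cong (P i j *_) (hit-agree R closed agree k (closed r e))
    ... | inj₂ z = trans (cong (_* hit P S k j) z)
      (trans (*-zeroˡ (hit P S k j)) (sym (trans (cong (_* hit P S′ k j) z) (*-zeroˡ (hit P S′ k j)))))

  -- Survival in a transient set

  module Survival (T : Fin n → Bool) (escape : ∀ i → Reach (not ∘ T) i) where

    -- The probability that the states at times 0, ..., k-1 all lie in `T`; the state at time k is
    -- unconstrained, so `survive 0` is 1 even outside `T`.
    survive : ℕ → Vector ℚ n
    survive zero    i = 1ℚ
    survive (suc k) i = if T i then (P · survive k) i else 0ℚ

    survive-bounds : ∀ k i → 0ℚ ≤ survive k i × survive k i ≤ 1ℚ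
    survive-bounds zero    i = nonNegative⁻¹ 1ℚ , ≤-refl
    survive-bounds (suc k) i with T i
    ... | true  = ·-nonNeg (proj₁ ∘ survive-bounds k) i , ·-≤ (proj₂ ∘ survive-bounds k) i
    ... | false = ≤-refl , nonNegative⁻¹ 1ℚ

    survive-step : ∀ k i → survive (suc k) i ≤ survive k i
    survive-step zero    i = proj₂ (survive-bounds 1 i)
    survive-step (suc k) i with T i
    ... | true  = ·-mono (survive-step k) i
    ... | false = ≤-refl

    survive-antitone : ∀ {k l} → k ℕ.≤ l → ∀ i → survive l i ≤ survive k i
    survive-antitone {k} k≤l i with ℕ.≤⇒≤′ k≤l
    ... | k≤′l = go k≤′l
      where
      go : ∀ {l} → k ℕ.≤′ l → survive l i ≤ survive k i
      go ℕ.≤′-refl         = ≤-refl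
      go (ℕ.≤′-step {l} p) = ≤-trans (survive-step l i) (go p)

    -- Induction along a path out of `T`: a deficit `1 - survive k j` at a successor `j` leaves at
    -- least `P i j` times that deficit at `i` one step later.
    survive<1 : ∀ i → ∃ λ k → survive k i < 1ℚ
    survive<1 i = go (escape i)
      where
      dead : ∀ {i} → not (T i) ≡ true → survive 1 i < 1ℚ
      dead {i} s with T i
      ... | false = positive⁻¹ 1ℚ
      go : ∀ {i} → Reach (not ∘ T) i → ∃ λ k → survive k i < 1ℚ
      go (stop s) = 1 , dead s
      go {i} (step {j} e p) with go p
      ... | k , h = suc k , lemma
        where
        cancel : ∀ x → x ≡ 1ℚ - (1ℚ - x)
        cancel = solve-∀ ℚ-ring
        lemma : survive (suc k) i < 1ℚ
        lemma with T i
        ... | false = positive⁻¹ 1ℚ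
        ... | true  = ≤-<-trans
          (·-gap {i = i} {j} {1ℚ - survive k j} (proj₂ ∘ survive-bounds k) (≤-reflexive (cancel (survive k j))))
          (0<-⇒< (subst (0ℚ <_) (cancel (P i j * (1ℚ - survive k j))) (0<* e (<⇒0<- h))))

    private
      abstract
        horizon : ∃ λ N → ∀ i → survive N i < 1ℚ
        horizon = uniform-index (λ k≤l h → ≤-<-trans (survive-antitone k≤l _) h) survive<1

      N : ℕ
      -- The successor guarantees that `occupation N` includes the summand `survive 0`, which makes
      -- it positive at every state.
      N = suc (proj₁ horizon)

      survive-N<1 : ∀ i → survive N i < 1ℚ
      survive-N<1 i = ≤-<-trans (survive-step (proj₁ horizon) i) (proj₂ horizon i)

      abstract
        gap : ∃ λ δ → 0ℚ < δ × (∀ i → δ ≤ 1ℚ - survive N i)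
        gap = lower-bound (λ i → 1ℚ - survive N i) (<⇒0<- ∘ survive-N<1)

      δ : ℚ
      δ = proj₁ gap

      0<δ : 0ℚ < δ
      0<δ = proj₁ (proj₂ gap)

    occupation : ℕ → Vector ℚ n
    occupation zero    i = 0ℚ
    occupation (suc k) i = occupation k i + 1ℚ * survive k i

    -- On `T` averaging shifts `survive t` to `survive (suc t)`, so the sum telescopes: it loses the
    -- first summand 1 and gains `survive k`.
    occupation-· : ∀ k {i} → T i ≡ true → (P · occupation k) i ≡ occupation k i - (1ℚ - survive k i)
    occupation-· zero    {i} Ti = ·-const 0ℚ i
    occupation-· (suc k) {i} Ti = begin
      (P · occupation (suc k)) i                         ≡⟨ ·-linear (occupation k) (survive k) 1ℚ i ⟩
      (P · occupation k) i + 1ℚ * (P · survive k) i      ≡⟨ cong₂ (λ x y → x + 1ℚ * y) (occupation-· k Ti) alive ⟩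
      occupation k i - (1ℚ - survive k i) + 1ℚ * survive (suc k) i
        ≡⟨ rearrange (occupation k i) (survive k i) (survive (suc k) i) ⟩
      occupation (suc k) i - (1ℚ - survive (suc k) i)    ∎
      where
      open ≡-Reasoning
      alive : (P · survive k) i ≡ survive (suc k) i
      alive rewrite Ti = refl
      rearrange : ∀ h u v → h - (1ℚ - u) + 1ℚ * v ≡ (h + 1ℚ * u) - (1ℚ - v)
      rearrange = solve-∀ ℚ-ring

    occupation>0 : ∀ k i → 0ℚ < occupation (suc k) i
    occupation>0 zero    i = positive⁻¹ 1ℚ
    occupation>0 (suc k) i =
      +-mono-<-≤ (occupation>0 k i) (0≤* (nonNegative⁻¹ 1ℚ) (proj₁ (survive-bounds (suc k) i)))

    abstract
      -- The expected time spent in T up to the horizon N.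
      potential : Vector ℚ n
      potential = occupation N

      potential>0 : ∀ i → 0ℚ < potential i
      potential>0 = occupation>0 (proj₁ horizon)

      potential-gap : ∀ {i} → T i ≡ true → (P · potential) i ≤ potential i - δ
      potential-gap {i} Ti = subst (_≤ potential i - δ) (sym (occupation-· N Ti))
        (+-monoʳ-≤ (potential i) (neg-antimono-≤ (proj₂ (proj₂ gap) i)))

    potential-decreases : ∀ {i} → T i ≡ true → (P · potential) i < potential i
    potential-decreases {i} Ti = ≤-<-trans (potential-gap Ti)
      (subst (potential i - δ <_) (+-identityʳ (potential i))
        (+-monoʳ-< (potential i) (neg-antimono-< 0<δ)))

    -- Each step taken inside T costs at least δ of potential.
    survive-decay : ∀ k i → fromℤ (+ k) * δ * survive k i ≤ potential i
    survive-decay zero i = subst (_≤ potential i) (sym (zero-product δ)) (<⇒≤ (potential>0 i))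
      where
      zero-product : ∀ d → 0ℚ * d * 1ℚ ≡ 0ℚ
      zero-product = solve-∀ ℚ-ring
    survive-decay (suc k) i with T i in Ti
    ... | false = subst (_≤ potential i) (sym (*-zeroʳ (fromℤ (+ suc k) * δ))) (<⇒≤ (potential>0 i))
    ... | true  = begin
      fromℤ (+ suc k) * δ * s                     ≡⟨ cong (λ z → z * δ * s) (sym (fromℤ-+ (+ 1) (+ k))) ⟩
      (1ℚ + fromℤ (+ k)) * δ * s                  ≡⟨ expanded (fromℤ (+ k)) δ s ⟩
      (fromℤ (+ k) * δ) * s + δ * s               ≡⟨ cong (_+ δ * s) (sym (·-scale (survive k) (fromℤ (+ k) * δ) i)) ⟩
      (P · (λ j → fromℤ (+ k) * δ * survive k j)) i + δ * s
        ≤⟨ +-mono-≤ (·-mono (survive-decay k) i) (*-monoˡ-≤-nonNeg δ {{nonNegative (<⇒≤ 0<δ)}} (·-≤ (proj₂ ∘ survive-bounds k) i)) ⟩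
      (P · potential) i + δ * 1ℚ                  ≤⟨ +-monoˡ-≤ (δ * 1ℚ) (potential-gap Ti) ⟩
      potential i - δ + δ * 1ℚ                    ≡⟨ cancel (potential i) δ ⟩
      potential i                                 ∎
      where
      open ≤-Reasoning
      s : ℚ
      s = (P · survive k) i
      expanded : ∀ k d s → (1ℚ + k) * d * s ≡ (k * d) * s + d * s
      expanded = solve-∀ ℚ-ring
      cancel : ∀ h d → h - d + d * 1ℚ ≡ h
      cancel = solve-∀ ℚ-ring

    -- If `survive k i` were at least ε, `survive-decay` would bound k δ ε by the maximum of the
    -- potential, which fails for large k.
    survive→0 : ∀ ε → 0ℚ < ε → ∃ λ K → ∀ k → K ℕ.≤ k → ∀ i → survive k i < ε
    survive→0 ε 0<ε = proj₁ large , λ k K≤k i → ≰⇒> λ ε≤s → <-irrefl refl (<-≤-trans (proj₂ large k K≤k) (bound k i ε≤s))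
      where
      C : ℚ
      C = proj₁ (upper-bound potential)
      large : ∃ λ K → ∀ k → K ℕ.≤ k → C < fromℤ (+ k) * (δ * ε)
      large = archimedean C (0<* 0<δ 0<ε)
      bound : ∀ k i → ε ≤ survive k i → fromℤ (+ k) * (δ * ε) ≤ C
      bound k i ε≤s = begin
        fromℤ (+ k) * (δ * ε)          ≡⟨ sym (*-assoc (fromℤ (+ k)) δ ε) ⟩
        fromℤ (+ k) * δ * ε            ≤⟨ *-monoˡ-≤-nonNeg (fromℤ (+ k) * δ) {{nonNegative (0≤* (0≤fromℕ k) (<⇒≤ 0<δ))}} ε≤s ⟩
        fromℤ (+ k) * δ * survive k i  ≤⟨ survive-decay k i ⟩
        potential i                    ≤⟨ proj₂ (proj₂ (upper-bound potential)) i ⟩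
        C                              ∎
        where open ≤-Reasoning

  -- Missing `S` at the times 0, ..., k means staying in its complement at `suc k` times, whence the
  -- shifted index.
  hit-survive : ∀ S (escape : ∀ i → Reach (not ∘ not ∘ S) i) k i →
    hit P S k i ≡ 1ℚ - Survival.survive (not ∘ S) escape (suc k) i
  hit-survive S escape zero i with S i
  ... | true  = refl
  ... | false = sym (cong (λ z → 1ℚ - z) (·-const 1ℚ i))
  hit-survive S escape (suc k) i with S i
  ... | true  = refl
  ... | false = begin
    (P · hit P S k) i                                 ≡⟨ sum-cong (λ j → cong (P i j *_) (trans (hit-survive S escape k j) (minus 1ℚ (v j)))) ⟩
    (P · (λ j → 1ℚ + (- 1ℚ) * v j)) i                 ≡⟨ ·-linear (λ _ → 1ℚ) v (- 1ℚ) i ⟩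
    (P · (λ _ → 1ℚ)) i + (- 1ℚ) * (P · v) i           ≡⟨ cong (_+ (- 1ℚ) * (P · v) i) (·-const 1ℚ i) ⟩
    1ℚ + (- 1ℚ) * (P · v) i                           ≡⟨ sym (minus 1ℚ ((P · v) i)) ⟩
    1ℚ - (P · v) i                                    ∎
    where
    open ≡-Reasoning
    v : Vector ℚ n
    v = Survival.survive (not ∘ S) escape (suc k)

  -- Recurrence

  -- The decidable, purely combinatorial counterpart of `Recurrent`; on a finite state space the two
  -- agree.
  Essential : Fin n → Set
  Essential i = ∀ j → Reaches i j → Reaches j i

  essential? : ∀ i → Dec (Essential i)
  essential? i = all? (λ j → reaches? i j →-dec reaches? j i)

  Essential-Reaches : ∀ {i j} → Essential i → Reaches i j → Essential j
  Essential-Reaches ess ij k jk = Reaches-Reach (ess k (Reaches-Reach ij jk)) ij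

  -- The states that cannot reach i are made absorbing along with i: then every
  -- state reaches the absorbing set, and nothing changes for states reachable from i.
  Essential⇒Recurrent : ∀ {i} → Essential i → Recurrent P i
  Essential⇒Recurrent {i} ess ε 0<ε with <-dense 0<ε
  ... | η , 0<η , η<ε = suc (proj₁ small) , close
    where
    S : Fin n → Bool
    S j = singleton i j ∨ not (does (reaches? j i))

    Reach-∨ : ∀ {j} → Reaches j i → Reach S j
    Reach-∨ {j} (stop s) = stop (cong (_∨ not (does (reaches? j i))) s)
    Reach-∨ (step e p)   = step e (Reach-∨ p)

    absorbed : ∀ j → Reach S j
    absorbed j with reaches? j i in eq
    ... | yes p = Reach-∨ p
    ... | no ¬p = stop (trans (cong (λ d → singleton i j ∨ not (does d)) eq) (Bool.∨-zeroʳ (singleton i j)))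

    not-not : ∀ {j} → Reach S j → Reach (not ∘ not ∘ S) j
    not-not {j} (stop s) = stop (trans (Bool.not-involutive (S j)) s)
    not-not (step e p)   = step e (not-not p)

    escape : ∀ j → Reach (not ∘ not ∘ S) j
    escape j = not-not (absorbed j)

    open Survival (not ∘ S) escape

    agree : ∀ {j} → Reaches i j → singleton i j ≡ S j
    agree {j} ij = sym (trans (cong (λ b → singleton i j ∨ not b) (dec-true (reaches? j i) (ess j ij)))
                              (Bool.∨-identityʳ (singleton i j)))

    extend : ∀ {j k} → Reaches i j → 0ℚ < P j k → Reaches i k
    extend ij e = Reaches-Reach ij (step e Reaches-refl)


    -- Successors of positive probability are reachable from `i`, where `S` and `singleton i` agree,
    -- so `hit-agree` exchanges the targets; all other terms are zero.
    ret-survive : ∀ k → ret P i (suc k) ≡ 1ℚ + (- 1ℚ) * (P · survive (suc k)) i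
    ret-survive k = trans (sum-cong term)
      (trans (·-linear (λ _ → 1ℚ) (survive (suc k)) (- 1ℚ) i) (cong (_+ (- 1ℚ) * (P · survive (suc k)) i) (·-const 1ℚ i)))
      where
      term : ∀ j → P i j * hit P (singleton i) k j ≡ P i j * (1ℚ + (- 1ℚ) * survive (suc k) j)
      term j with edge-or-zero i j
      ... | inj₁ e = cong (P i j *_) (trans (hit-agree (Reaches i) extend agree k (extend Reaches-refl e))
                                            (trans (hit-survive S escape k j) (minus 1ℚ (survive (suc k) j))))
      ... | inj₂ z = trans (cong (_* hit P (singleton i) k j) z) (trans (*-zeroˡ (hit P (singleton i) k j))
                       (sym (trans (cong (_* x) z) (*-zeroˡ x))))
        where
        x : ℚ
        x = 1ℚ + (- 1ℚ) * survive (suc k) j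

    small : ∃ λ K → ∀ k → K ℕ.≤ k → ∀ j → survive k j < η
    small = survive→0 η 0<η

    error : ∀ x → (1ℚ + (- 1ℚ) * x) - 1ℚ ≡ - x
    error = solve-∀ ℚ-ring

    close : ∀ k → suc (proj₁ small) ℕ.≤ k → ∣ ret P i k - 1ℚ ∣ < ε
    -- The averaging bound `·-≤` yields only `≤ η`; choosing η strictly below ε restores the strict
    -- inequality.
    close (suc k) (ℕ.s≤s K≤k) = subst (_< ε) (sym abs) (≤-<-trans
      (·-≤ (λ j → <⇒≤ (proj₂ small (suc k) (ℕ.m≤n⇒m≤1+n K≤k) j)) i) η<ε)
      where
      s : ℚ
      s = (P · survive (suc k)) i
      abs : ∣ ret P i (suc k) - 1ℚ ∣ ≡ s
      abs = begin
        ∣ ret P i (suc k) - 1ℚ ∣            ≡⟨ cong (λ z → ∣ z - 1ℚ ∣) (ret-survive k) ⟩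
        ∣ (1ℚ + (- 1ℚ) * s) - 1ℚ ∣          ≡⟨ cong ∣_∣ (error s) ⟩
        ∣ - s ∣                             ≡⟨ ∣-p∣≡∣p∣ s ⟩
        ∣ s ∣                               ≡⟨ 0≤p⇒∣p∣≡p (·-nonNeg (proj₁ ∘ survive-bounds (suc k)) i) ⟩
        s                                   ∎
        where open ≡-Reasoning

  -- Recurrent states are essential

  module _ {i : Fin n} where

    -- The gap ε is uniform in `k`, so it persists in the limit.
    Avoids : Fin n → Set
    Avoids v = ∃ λ ε → 0ℚ < ε × (∀ k → hit P (singleton i) k v ≤ 1ℚ - ε)

    Escapes : Set
    Escapes = ∃ λ w → 0ℚ < P i w × Avoids w

    hit≤1 : ∀ k v → hit P (singleton i) k v ≤ 1ℚ
    hit≤1 k v = proj₂ (hit-bounds (singleton i) k v)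

    Avoids-step : ∀ {v w} → i ≢ v → 0ℚ < P v w → Avoids w → Avoids v
    Avoids-step {v} {w} i≢v e (ε , 0<ε , h) = P v w * ε , 0<* e 0<ε , bound
      where
      not-here : singleton i v ≡ false
      not-here with i ≟ᶠ v
      ... | yes p = contradiction p i≢v
      ... | no _  = refl
      bound : ∀ k → hit P (singleton i) k v ≤ 1ℚ - P v w * ε
      bound zero rewrite not-here =
        ≤-trans (·-nonNeg (λ j → proj₁ (hit-bounds (singleton i) 0 j)) v) (·-gap (hit≤1 0) (h 0))
      bound (suc k) rewrite not-here = ·-gap (hit≤1 k) (h k)

    -- Avoidance passes from the end of the path to its predecessors until the path meets `i`; the
    -- state just after that last visit to `i` is the escape.
    walk-back : ∀ {v j} → Reaches v j → Avoids j → Avoids v ⊎ Escapes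
    walk-back (stop j≡v) a with singleton-true j≡v
    ... | refl = inj₁ a
    walk-back {v} (step {w} e p) a with walk-back p a
    ... | inj₂ esc = inj₂ esc
    ... | inj₁ a′ with i ≟ᶠ v
    ...   | yes refl = inj₂ (w , e , a′)
    ...   | no i≢v   = inj₁ (Avoids-step i≢v e a′)

    ¬Avoids-self : ¬ Avoids i
    ¬Avoids-self (ε , 0<ε , h) = <-irrefl refl (<-≤-trans 0<ε ε≤0)
      where
      cancel : ∀ ε → (1ℚ - ε) - 1ℚ ≡ - ε
      cancel = solve-∀ ℚ-ring
      drop : ∀ ε → 0ℚ - - ε ≡ ε
      drop = solve-∀ ℚ-ring
      0≤-ε : 0ℚ ≤ - ε
      0≤-ε = subst (0ℚ ≤_) (cancel ε) (≤⇒0≤- (subst (_≤ 1ℚ - ε) (hit≡1 {singleton i} 0 {i} (singleton-refl i)) (h 0)))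
      ε≤0 : ε ≤ 0ℚ
      ε≤0 = 0≤-⇒≤ (subst (0ℚ ≤_) (sym (+-identityˡ (- ε))) 0≤-ε)

    Escapes⇒¬Recurrent : Escapes → ¬ Recurrent P i
    Escapes⇒¬Recurrent (w , e , ε , 0<ε , h) rec = <-irrefl refl (<-≤-trans near far)
      where
      η : ℚ
      η = P i w * ε
      0<η : 0ℚ < η
      0<η = 0<* e 0<ε
      K : ℕ
      K = proj₁ (rec η 0<η)
      near : ∣ ret P i (suc K) - 1ℚ ∣ < η
      near = proj₂ (rec η 0<η) (suc K) (ℕ.n≤1+n K)
      swap : ∀ η x → 1ℚ - η - x ≡ (1ℚ - x) - η
      swap = solve-∀ ℚ-ring
      gap : η ≤ 1ℚ - ret P i (suc K)
      gap = 0≤-⇒≤ (subst (0ℚ ≤_) (swap η (ret P i (suc K))) (≤⇒0≤- (·-gap (hit≤1 K) (h K))))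
      flip : ∀ x → - (x - 1ℚ) ≡ 1ℚ - x
      flip = solve-∀ ℚ-ring
      far : η ≤ ∣ ret P i (suc K) - 1ℚ ∣
      far = ≤-trans gap (≤-reflexive (sym (begin
        ∣ x - 1ℚ ∣       ≡⟨ sym (∣-p∣≡∣p∣ (x - 1ℚ)) ⟩
        ∣ - (x - 1ℚ) ∣   ≡⟨ cong ∣_∣ (flip x) ⟩
        ∣ 1ℚ - x ∣       ≡⟨ 0≤p⇒∣p∣≡p (≤-trans (<⇒≤ 0<η) gap) ⟩
        1ℚ - x           ∎)))
        where
        open ≡-Reasoning
        x : ℚ
        x = ret P i (suc K)

    Recurrent⇒Essential : Recurrent P i → Essential i
    Recurrent⇒Essential rec j ij with reaches? j i
    ... | yes ji = ji
    ... | no ¬ji with walk-back ij (1ℚ , positive⁻¹ 1ℚ , λ k → ≤-reflexive (hit≡0 k ¬ji))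
    ...   | inj₁ a   = contradiction a ¬Avoids-self
    ...   | inj₂ esc = contradiction rec (Escapes⇒¬Recurrent esc)

  -- An inessential state reaches some `j` that does not lead back. The set of states reachable from
  -- `j` is then strictly smaller, as it lacks `i`, so repeating this must end outside `T`.
  reaches-essential : ∀ {T} → (∀ {i} → T i ≡ true → ¬ Essential i) → ∀ i → Reach (not ∘ T) i
  reaches-essential {T} inessential i = go i (<-wellFounded _)
    where
    future : Fin n → Fin n → Bool
    future i j = does (reaches? i j)
    go : ∀ i → Acc ℕ._<_ (count (future i)) → Reach (not ∘ T) i
    go i (acc rec) with T i in eq
    ... | false = stop (cong not eq)
    ... | true with ¬∀⟶∃¬ n _ (λ j → reaches? i j →-dec reaches? j i) (inessential eq)
    ...   | j , ¬back = Reaches-Reach ij (go j (rec (count-strict shrink i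
            (dec-false (reaches? j i) (λ ji → ¬back (λ _ → ji))) (dec-true (reaches? i i) Reaches-refl))))
      where
      ij : Reaches i j
      ij = decidable-stable (reaches? i j) (λ ¬ij → ¬back (λ ij → contradiction ij ¬ij))
      shrink : ∀ k → future j k ≡ true → future i k ≡ true
      shrink k jk = dec-true (reaches? i k) (Reaches-Reach ij (does⁻ (reaches? j k) jk))

-- Common multiples, products over `T`, and the identity matrix

lcmFin-∣ : ∀ {n} (f : Fin n → ℕ) i → f i ∣ lcmFin f
lcmFin-∣ f zero    = m∣lcm[m,n] (f zero) (lcmFin (f ∘ suc))
lcmFin-∣ f (suc i) = ∣-trans (lcmFin-∣ (f ∘ suc) i) (n∣lcm[m,n] (f zero) (lcmFin (f ∘ suc)))

-- The lcm divides the product, so a zero lcm would force a zero product.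
lcmFin>0 : ∀ {n} (f : Fin n → ℕ) → (∀ i → 0 ℕ.< f i) → 0 ℕ.< lcmFin f
lcmFin>0 {zero}  f f>0 = ℕ.z<s
lcmFin>0 {suc n} f f>0 = ℕ.n≢0⇒n>0 λ lcm≡0 →
  ℕ.<-irrefl (sym (0∣⇒≡0 (subst (_∣ f zero ℕ.* l) lcm≡0 (lcm-least (m∣m*n {f zero} l) (n∣m*n (f zero))))))
             (ℕ.*-mono-< (f>0 zero) (lcmFin>0 (f ∘ suc) (f>0 ∘ suc)))
  where
  l : ℕ
  l = lcmFin (f ∘ suc)

prodOver>0 : ∀ {n} T (f : Fin n → ℕ) → (∀ i → 0 ℕ.< f i) → 0 ℕ.< prodOver T f
prodOver>0 {zero}  T f f>0 = ℕ.z<s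
prodOver>0 {suc n} T f f>0 with T zero
... | true  = ℕ.*-mono-< (f>0 zero) (prodOver>0 (T ∘ suc) (f ∘ suc) (f>0 ∘ suc))
... | false = ℕ.*-mono-< {0} {1} ℕ.z<s (prodOver>0 (T ∘ suc) (f ∘ suc) (f>0 ∘ suc))

prodOver≤^count : ∀ {n} T (f : Fin n → ℕ) m → (∀ i → f i ℕ.≤ m) → prodOver T f ℕ.≤ m ^ count T
prodOver≤^count {zero}  T f m f≤m = ℕ.≤-refl
prodOver≤^count {suc n} T f m f≤m with T zero
... | true  = ℕ.*-mono-≤ (f≤m zero) (prodOver≤^count (T ∘ suc) (f ∘ suc) m (f≤m ∘ suc))
... | false = ℕ.≤-trans (ℕ.≤-reflexive (ℕ.*-identityˡ _)) (prodOver≤^count (T ∘ suc) (f ∘ suc) m (f≤m ∘ suc))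

count-not : ∀ {n} (T : Fin n → Bool) → count T ℕ.+ count (not ∘ T) ≡ n
count-not {zero}  T = refl
count-not {suc n} T with T zero
... | true  = cong suc (count-not (T ∘ suc))
... | false = trans (ℕ.+-suc (count (T ∘ suc)) _) (cong suc (count-not (T ∘ suc)))

count>0 : ∀ {n} {f : Fin n → Bool} i → f i ≡ true → 0 ℕ.< count f
count>0 zero    fi rewrite fi = ℕ.z<s
count>0 {f = f} (suc i) fi = ℕ.≤-trans (count>0 i fi) (ℕ.m≤n+m _ (if f zero then 1 else 0))

count≤1 : ∀ {n} (f : Fin n → Bool) → count f ℕ.≤ 1 → ∀ i j → f i ≡ true → f j ≡ true → i ≡ j
count≤1 f c zero    zero    fi fj = refl
count≤1 f c zero    (suc j) fi fj rewrite fi = contradiction (ℕ.s≤s⁻¹ c) (ℕ.<⇒≱ (count>0 j fj))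
count≤1 f c (suc i) zero    fi fj rewrite fj = contradiction (ℕ.s≤s⁻¹ c) (ℕ.<⇒≱ (count>0 i fi))
count≤1 f c (suc i) (suc j) fi fj =
  cong suc (count≤1 (f ∘ suc) (ℕ.≤-trans (ℕ.m≤n+m _ (if f zero then 1 else 0)) c) i j fi fj)

δᴷ : ∀ {n} → Matrix n
δᴷ i j = if singleton i j then 1ℚ else 0ℚ

δᴷ-refl : ∀ {n} (i : Fin n) → δᴷ i i ≡ 1ℚ
δᴷ-refl i = cong (if_then 1ℚ else 0ℚ) (singleton-refl i)

δᴷ-off : ∀ {n} {i j : Fin n} → i ≢ j → δᴷ i j ≡ 0ℚ
δᴷ-off {i = i} {j} i≢j with i ≟ᶠ j
... | yes i≡j = contradiction i≡j i≢j
... | no _    = refl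

δᴷ-· : ∀ {n} (x : Vector ℚ n) i → (δᴷ · x) i ≡ x i
δᴷ-· x i = trans (sum-single _ i (λ k k≢i → trans (cong (_* x k) (δᴷ-off (k≢i ∘ sym))) (*-zeroˡ (x k))))
                 (trans (cong (_* x i) (δᴷ-refl i)) (*-identityˡ (x i)))

δᴷ-integral : ∀ {n} (i j : Fin n) → Integral (δᴷ i j)
δᴷ-integral i j with singleton i j
... | true  = + 1 , refl
... | false = + 0 , refl

-- Absorption in a recurrent class

module Absorption {n} (P : Matrix n) (stochastic : Stochastic P)
  (T : Fin n → Bool) (transient : ∀ i → (T i ≡ true) ⇔ (¬ Recurrent P i)) where

  open Chain P stochastic

  T⇒inessential : ∀ {i} → T i ≡ true → ¬ Essential i
  T⇒inessential Ti ess = Equivalence.to (transient _) Ti (Essential⇒Recurrent ess)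

  ¬T⇒essential : ∀ {i} → T i ≡ false → Essential i
  ¬T⇒essential {i} Ti = decidable-stable (essential? i) λ ¬ess →
    false≢true Ti (Equivalence.from (transient i) (¬ess ∘ Recurrent⇒Essential))

  essential⇒¬T : ∀ {i} → Essential i → T i ≡ false
  essential⇒¬T {i} ess with T i in eq
  ... | true  = contradiction ess (T⇒inessential eq)
  ... | false = refl

  open Survival T (reaches-essential T⇒inessential)

  -- The right-hand side of the system. For recurrent `r` the states reachable from `r` are exactly
  -- its class, so outside `T` this is the indicator of the class.
  boundary : Fin n → Vector ℚ n
  boundary r i = if T i then 0ℚ else if does (reaches? r i) then 1ℚ else 0ℚ

  -- Exactly what identifies `x` as the limit; both the solution of the system and, for a single
  -- recurrent state, the constant 1 fit.
  record Harmonic (r : Fin n) (x : Vector ℚ n) : Set where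
    field
      inside  : ∀ {i} → T i ≡ true → x i ≡ (P · x) i
      outside : ∀ {i} → T i ≡ false → x i ≡ boundary r i

  module _ {r} (recurrent : Recurrent P r) {S : Fin n → Bool}
    (class : ∀ j → (S j ≡ true) ⇔ Communicate P r j) {x : Vector ℚ n} (harmonic : Harmonic r x) where

    open Harmonic harmonic

    private
      essential : Essential r
      essential = Recurrent⇒Essential recurrent

    Reaches⇒S : ∀ {j} → Reaches r j → S j ≡ true
    Reaches⇒S rj = Equivalence.from (class _)
      (Equivalence.to Reach⇔hit>0 rj , Equivalence.to Reach⇔hit>0 (essential _ rj))

    S⇒Reaches : ∀ {j} → S j ≡ true → Reaches r j
    S⇒Reaches Sj = Equivalence.from Reach⇔hit>0 (proj₁ (Equivalence.to (class _) Sj))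

    -- Outside `T` the outcome is settled at time 0: an essential state that reaches the class is
    -- reached back from it, hence belongs to it.
    hit-outside : ∀ k {i} → T i ≡ false → hit P S k i ≡ x i
    hit-outside k {i} Ti = trans value (sym (trans (outside Ti) (cong (if_then 0ℚ else if does (reaches? r i) then 1ℚ else 0ℚ) Ti)))
      where
      value : hit P S k i ≡ (if does (reaches? r i) then 1ℚ else 0ℚ)
      value with reaches? r i
      ... | yes ri = hit≡1 k (Reaches⇒S ri)
      ... | no ¬ri = hit≡0 k λ p → let s , Ss , is = Reach⇒Reaches p in
              ¬ri (Reaches-Reach (S⇒Reaches Ss) (¬T⇒essential Ti s is))

    T⇒¬S : ∀ {i} → T i ≡ true → S i ≡ false
    T⇒¬S {i} Ti with S i in eq
    ... | false = refl
    ... | true  = contradiction Ti (false≢true (essential⇒¬T (Essential-Reaches essential (S⇒Reaches eq))))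

    private
      error : ℕ → Vector ℚ n
      error k i = hit P S k i - x i

      abstract
        initial : ∃ λ C → 0ℚ < C × (∀ i → ∣ error 0 i ∣ ≤ C)
        initial = upper-bound (λ i → ∣ error 0 i ∣)

      C : ℚ
      C = proj₁ initial

      0<C : 0ℚ < C
      0<C = proj₁ (proj₂ initial)

    error-step : ∀ k {i} → T i ≡ true → error (suc k) i ≡ (P · error k) i
    error-step k {i} Ti = begin
      hit P S (suc k) i - x i                      ≡⟨ cong₂ _-_ (cong (if_then 1ℚ else (P · hit P S k) i) (T⇒¬S Ti)) (inside Ti) ⟩
      (P · hit P S k) i - (P · x) i                ≡⟨ minus ((P · hit P S k) i) ((P · x) i) ⟩
      (P · hit P S k) i + (- 1ℚ) * (P · x) i       ≡⟨ sym (·-linear (hit P S k) x (- 1ℚ) i) ⟩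
      (P · (λ j → hit P S k j + (- 1ℚ) * x j)) i   ≡⟨ sum-cong (λ j → cong (P i j *_) (sym (minus (hit P S k j) (x j)))) ⟩
      (P · error k) i                              ∎
      where
      open ≡-Reasoning

    -- Comparison of two recursions: on `T` both sides evolve by averaging with `P`, and outside `T`
    -- the error is zero.
    error≤ : ∀ k i → ∣ error k i ∣ ≤ C * survive k i
    error≤ zero    i = ≤-trans (proj₂ (proj₂ initial) i) (≤-reflexive (sym (*-identityʳ C)))
    error≤ (suc k) i = go (T i) refl
      where
      open ≤-Reasoning
      go : ∀ b → T i ≡ b → ∣ error (suc k) i ∣ ≤ C * (if b then (P · survive k) i else 0ℚ)
      go false Ti = ≤-reflexive (begin-equality
        ∣ hit P S (suc k) i - x i ∣   ≡⟨ cong (λ z → ∣ z - x i ∣) (hit-outside (suc k) Ti) ⟩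
        ∣ x i - x i ∣                 ≡⟨ cong ∣_∣ (+-inverseʳ (x i)) ⟩
        0ℚ                            ≡⟨ sym (*-zeroʳ C) ⟩
        C * 0ℚ                        ∎)
      go true Ti = begin
        ∣ error (suc k) i ∣                         ≡⟨ cong ∣_∣ (error-step k Ti) ⟩
        ∣ (P · error k) i ∣                         ≤⟨ ∣·∣≤ (error k) i ⟩
        (P · (λ j → ∣ error k j ∣)) i               ≤⟨ ·-mono (error≤ k) i ⟩
        (P · (λ j → C * survive k j)) i             ≡⟨ ·-scale (survive k) C i ⟩
        C * (P · survive k) i                       ∎

    hit-converges : ∀ i → Converges (λ k → hit P S k i) (x i)
    hit-converges i ε 0<ε with inverse 0<C
    ... | r , 0<r , Cr≡1 = proj₁ small , λ k K≤k → ≤-<-trans (error≤ k i)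
          (subst (C * survive k i <_) Crε≡ε (*-monoʳ-<-pos C {{positive 0<C}} (proj₂ small k K≤k i)))
      where
      small : ∃ λ K → ∀ k → K ℕ.≤ k → ∀ j → survive k j < r * ε
      small = survive→0 (r * ε) (0<* 0<r 0<ε)
      Crε≡ε : C * (r * ε) ≡ ε
      Crε≡ε = trans (sym (*-assoc C r ε)) (trans (cong (_* ε) Cr≡1) (*-identityˡ ε))

  -- The linear system for the absorption probabilities

  rowLCD>0 : ∀ i → 0 ℕ.< rowLCD P i
  rowLCD>0 i = lcmFin>0 (λ j → den (P i j)) (λ _ → ℕ.z<s)

  scale : Fin n → ℕ
  scale i = if T i then rowLCD P i else 1

  restricted : Matrix n
  restricted i j = if T i then P i j else 0ℚ

  -- Row i of I − P cleared of denominators for i ∈ T, and row i of I for i ∉ T.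
  system : Matrix n
  system i j = fromℤ (+ scale i) * (δᴷ i j + (- 1ℚ) * restricted i j)

  scale>0 : ∀ i → 0ℚ < fromℤ (+ scale i)
  scale>0 i = <-≤-trans (positive⁻¹ 1ℚ) (fromℤ-mono-≤ {+ 1} {+ scale i} (ℤ.+≤+ positive-scale))
    where
    positive-scale : 1 ℕ.≤ scale i
    positive-scale with T i
    ... | true  = rowLCD>0 i
    ... | false = ℕ.≤-refl

  system-· : ∀ x i → (system · x) i ≡ fromℤ (+ scale i) * (x i - (if T i then (P · x) i else 0ℚ))
  system-· x i = begin
    sumℚ (λ j → s * (δᴷ i j + (- 1ℚ) * restricted i j) * x j)
      ≡⟨ sum-cong (λ j → rearrange s (δᴷ i j) (restricted i j) (x j)) ⟩
    sumℚ (λ j → 0ℚ + s * (δᴷ i j * x j + (- 1ℚ) * (restricted i j * x j)))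
      ≡⟨ sum-linear (λ _ → 0ℚ) (λ j → δᴷ i j * x j + (- 1ℚ) * (restricted i j * x j)) s ⟩
    sumℚ {n} (λ _ → 0ℚ) + s * sumℚ (λ j → δᴷ i j * x j + (- 1ℚ) * (restricted i j * x j))
      ≡⟨ cong₂ (λ y z → y + s * z) (sum-zero {n} (λ _ → 0ℚ) (λ _ → refl))
           (sum-linear (λ j → δᴷ i j * x j) (λ j → restricted i j * x j) (- 1ℚ)) ⟩
    0ℚ + s * ((δᴷ · x) i + (- 1ℚ) * (restricted · x) i)
      ≡⟨ cong₂ (λ y z → 0ℚ + s * (y + (- 1ℚ) * z)) (δᴷ-· x i) restricted-· ⟩
    0ℚ + s * (x i + (- 1ℚ) * (if T i then (P · x) i else 0ℚ))
      ≡⟨ tidy s (x i) (if T i then (P · x) i else 0ℚ) ⟩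
    s * (x i - (if T i then (P · x) i else 0ℚ)) ∎
    where
    open ≡-Reasoning
    s : ℚ
    s = fromℤ (+ scale i)
    rearrange : ∀ s d p x → s * (d + (- 1ℚ) * p) * x ≡ 0ℚ + s * (d * x + (- 1ℚ) * (p * x))
    rearrange = solve-∀ ℚ-ring
    tidy : ∀ s x y → 0ℚ + s * (x + (- 1ℚ) * y) ≡ s * (x - y)
    tidy = solve-∀ ℚ-ring
    restricted-· : (restricted · x) i ≡ (if T i then (P · x) i else 0ℚ)
    restricted-· with T i
    ... | true  = refl
    ... | false = sum-zero _ (λ j → *-zeroˡ (x j))

  restricted≥0 : ∀ i j → 0ℚ ≤ restricted i j
  restricted≥0 i j with T i
  ... | true  = P≥0 i j
  ... | false = ≤-refl

  system-IsMMatrix : IsMMatrix system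
  system-IsMMatrix = record
    { off-diagonal = off
    ; witness      = potential
    ; witness>0    = potential>0
    ; image>0      = λ i → subst (0ℚ <_) (sym (system-· potential i)) (0<* (scale>0 i) (<⇒0<- (decrease i)))
    }
    where
    rearrange : ∀ s p → s * (0ℚ + (- 1ℚ) * p) ≡ - (s * p)
    rearrange = solve-∀ ℚ-ring
    off : ∀ i j → i ≢ j → system i j ≤ 0ℚ
    off i j i≢j = subst (_≤ 0ℚ)
      (sym (trans (cong (λ d → fromℤ (+ scale i) * (d + (- 1ℚ) * restricted i j)) (δᴷ-off i≢j))
                  (rearrange (fromℤ (+ scale i)) (restricted i j))))
      (neg-antimono-≤ (0≤* (<⇒≤ (scale>0 i)) (restricted≥0 i j)))
    decrease : ∀ i → (if T i then (P · potential) i else 0ℚ) < potential i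
    decrease i = go (T i) refl
      where
      go : ∀ b → T i ≡ b → (if b then (P · potential) i else 0ℚ) < potential i
      go true  Ti = potential-decreases Ti
      go false _  = potential>0 i

  -- The diagonal entry is `rowLCD P i` times `1 - P i i` on `T`, and 1 elsewhere.
  system-diagonal : ∀ i → system i i ≤ fromℤ (+ scale i)
  system-diagonal i = 0≤-⇒≤ (subst (0ℚ ≤_)
    (trans (rearrange (fromℤ (+ scale i)) (restricted i i))
           (cong (λ d → fromℤ (+ scale i) - fromℤ (+ scale i) * (d + (- 1ℚ) * restricted i i)) (sym (δᴷ-refl i))))
    (0≤* (<⇒≤ (scale>0 i)) (restricted≥0 i i)))
    where
    rearrange : ∀ s p → s * p ≡ s - s * (1ℚ + (- 1ℚ) * p)
    rearrange = solve-∀ ℚ-ring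

  system-integral : ∀ i → IntegralVector (system i)
  system-integral i j = subst Integral (sym (distribute (fromℤ (+ scale i)) (δᴷ i j) (restricted i j)))
    (Integral-+ (Integral-* (+ scale i , refl) (δᴷ-integral i j)) (Integral-neg cleared))
    where
    distribute : ∀ s d p → s * (d + (- 1ℚ) * p) ≡ s * d - s * p
    distribute = solve-∀ ℚ-ring
    cleared : Integral (fromℤ (+ scale i) * restricted i j)
    cleared with T i
    ... | true  = multiple-integral (rowLCD P i) (P i j) (lcmFin-∣ (λ j → den (P i j)) j)
    ... | false = + 0 , refl

  solution : ∀ r → ∃ λ x → ∀ i → (system · x) i ≡ boundary r i
  solution r = IsMMatrix⇒solvable system-IsMMatrix (boundary r)

  solution-harmonic : ∀ r → Harmonic r (proj₁ (solution r))
  solution-harmonic r = record { inside = inside ; outside = outside }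
    where
    x : Vector ℚ n
    x = proj₁ (solution r)
    equation : ∀ i → fromℤ (+ scale i) * (x i - (if T i then (P · x) i else 0ℚ)) ≡ boundary r i
    equation i = trans (sym (system-· x i)) (proj₂ (solution r) i)
    cancel-scale : ∀ {s y} → 0ℚ < s → s * y ≡ 0ℚ → y ≡ 0ℚ
    cancel-scale {s} {y} 0<s sy≡0 with inverse 0<s
    ... | r , _ , sr≡1 = begin
      y              ≡⟨ sym (*-identityˡ y) ⟩
      1ℚ * y         ≡⟨ cong (_* y) (sym sr≡1) ⟩
      s * r * y      ≡⟨ rearrange s r y ⟩
      r * (s * y)    ≡⟨ cong (r *_) sy≡0 ⟩
      r * 0ℚ         ≡⟨ *-zeroʳ r ⟩
      0ℚ             ∎
      where
      open ≡-Reasoning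
      rearrange : ∀ s r y → s * r * y ≡ r * (s * y)
      rearrange = solve-∀ ℚ-ring
    inside : ∀ {i} → T i ≡ true → x i ≡ (P · x) i
    inside {i} Ti = trans (sym (p-q+q≡p (x i) ((P · x) i))) (trans (cong (_+ (P · x) i) (cancel-scale {y = x i - (P · x) i} (scale>0 i) homogeneous)) (+-identityˡ _))
      where
      homogeneous : fromℤ (+ scale i) * (x i - (P · x) i) ≡ 0ℚ
      homogeneous = trans (cong (λ b → fromℤ (+ scale i) * (x i - (if b then (P · x) i else 0ℚ))) (sym Ti))
        (trans (equation i) (cong (if_then 0ℚ else if does (reaches? r i) then 1ℚ else 0ℚ) Ti))
    outside : ∀ {i} → T i ≡ false → x i ≡ boundary r i
    outside {i} Ti = trans (unit (x i)) (trans (cong (λ b → fromℤ (+ (if b then rowLCD P i else 1)) * (x i - (if b then (P · x) i else 0ℚ))) (sym Ti)) (equation i))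
      where
      unit : ∀ y → y ≡ 1ℚ * (y - 0ℚ)
      unit = solve-∀ ℚ-ring

  boundary-integral : ∀ r → IntegralVector (boundary r)
  boundary-integral r i with T i | does (reaches? r i)
  ... | true  | _     = + 0 , refl
  ... | false | true  = + 1 , refl
  ... | false | false = + 0 , refl

  determinant : Integral (det (columns system))
  determinant = det-integral (All.tabulate⁺ (λ j i → system-integral i j))

  -- The matrix does not depend on `r`, so this single number clears the solutions for all classes
  -- at once.
  common-denominator : ℕ
  common-denominator = ℤ.∣ proj₁ determinant ∣

  solution-den : ∀ i r → den (proj₁ (solution r) i) ∣ common-denominator
  solution-den i r = den-divides (x i) (proj₁ determinant)
    (subst (λ D → Integral (x i * D)) (proj₂ determinant)
      (cramer-integral system x system-integral (λ k → subst Integral (sym (proj₂ (solution r) k)) (boundary-integral r k)) i))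
    where
    x : Vector ℚ n
    x = proj₁ (solution r)

  common-denominator-bounds : 1 ℕ.≤ common-denominator × common-denominator ℕ.≤ DT P T
  common-denominator-bounds = natural (proj₁ determinant)
    (fromℤ-cancel-< {+ 0} (subst (0ℚ <_) (proj₂ determinant) (IsMMatrix⇒det>0 system-IsMMatrix)))
    (fromℤ-cancel-≤ {b = + DT P T} (subst₂ _≤_ (proj₂ determinant) (prodℚ-prodOver T (rowLCD P))
      (IsMMatrix⇒det≤∏ system-IsMMatrix (λ i → fromℤ (+ scale i)) system-diagonal)))
    where
    natural : ∀ {m} z → + 0 ℤ.< z → z ℤ.≤ + m → 1 ℕ.≤ ℤ.∣ z ∣ × ℤ.∣ z ∣ ℕ.≤ m
    natural (+ k) 0<z z≤m = ℤ.drop‿+<+ 0<z , ℤ.drop‿+≤+ z≤m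

  allLCD>0 : 0 ℕ.< allLCD P
  allLCD>0 = lcmFin>0 (rowLCD P) rowLCD>0

  rowLCD≤allLCD : ∀ i → rowLCD P i ℕ.≤ allLCD P
  rowLCD≤allLCD i = ∣⇒≤ {{ℕ.>-nonZero allLCD>0}} (lcmFin-∣ (rowLCD P) i)

  DT≤^ : 2 ℕ.≤ count (not ∘ T) → DT P T ℕ.≤ allLCD P ^ (n ∸ 2)
  DT≤^ two = ℕ.≤-trans (prodOver≤^count T (rowLCD P) (allLCD P) rowLCD≤allLCD)
    (ℕ.^-monoʳ-≤ (allLCD P) {{ℕ.>-nonZero allLCD>0}} fewer)
    where
    fewer : count T ℕ.≤ n ∸ 2
    fewer = ℕ.≤-trans (ℕ.≤-reflexive (sym (ℕ.m+n∸n≡m (count T) 2)))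
      (ℕ.∸-monoˡ-≤ 2 (ℕ.≤-trans (ℕ.+-monoʳ-≤ (count T) two) (ℕ.≤-reflexive (count-not T))))

  -- The only state outside `T` is `r` itself, where the boundary value is 1, and `P` preserves
  -- constants.
  one-harmonic : count (not ∘ T) ℕ.≤ 1 → ∀ {r} → Recurrent P r → Harmonic r (λ _ → 1ℚ)
  one-harmonic few {r} recurrent = record
    { inside  = λ {i} _ → sym (·-const 1ℚ i)
    ; outside = outside
    }
    where
    outside : ∀ {i} → T i ≡ false → 1ℚ ≡ boundary r i
    outside {i} Ti with count≤1 (not ∘ T) few r i (cong not (essential⇒¬T (Recurrent⇒Essential recurrent))) (cong not Ti)
    ... | refl rewrite Ti | dec-true (reaches? r r) Reaches-refl = refl

theorem1p3 : (n : ℕ) (P : Matrix n) → Stochastic P →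
    (T : Fin n → Bool) → (∀ i → (T i ≡ true) ⇔ (¬ Recurrent P i)) →
    Σ (Fin n → Fin n → ℚ) λ ψ →
    (∀ r → Recurrent P r → (S : Fin n → Bool) →
    (∀ j → (S j ≡ true) ⇔ Communicate P r j) →
    ∀ i → Converges (λ k → hit P S k i) (ψ i r))
    × Σ ℕ λ d → 1 ℕ.≤ d × d ℕ.≤ DT P T ⊓ (allLCD P ^ (n ∸ 2))
    × (∀ i r → Recurrent P r → den (ψ i r) ∣ d)
theorem1p3 n P stochastic T transient with 2 ℕ.≤? count (not ∘ T)
... | yes two =
    (λ i r → proj₁ (solution r) i) ,
    (λ r recurrent S class → hit-converges recurrent class (solution-harmonic r)) ,
    common-denominator , proj₁ common-denominator-bounds ,
    ℕ.⊓-glb (proj₂ common-denominator-bounds) (ℕ.≤-trans (proj₂ common-denominator-bounds) (DT≤^ two)) ,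
    (λ i r _ → solution-den i r)
  where open Absorption P stochastic T transient
-- With one state outside `T`, counting bounds `DT P T` only by the power n-1. The constant solution
-- 1 has denominator 1, and both bounds are at least 1.
... | no ¬two =
    (λ _ _ → 1ℚ) ,
    (λ r recurrent S class → hit-converges recurrent class (one-harmonic (ℕ.s≤s⁻¹ (ℕ.≰⇒> ¬two)) recurrent)) ,
    1 , ℕ.≤-refl ,
    ℕ.⊓-glb (prodOver>0 T (rowLCD P) rowLCD>0) (ℕ.m^n>0 (allLCD P) {{ℕ.>-nonZero allLCD>0}} (n ∸ 2)) ,
    (λ _ _ _ → ∣-refl)
  where open Absorption P stochastic T transient
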